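{- For every finite tree $T$ with $n$ vertices, $$F_T(x,y)=\sum_{i=1}^{n}\sum_{j=0}^{n-i}x^iy^j\sum_{\lambda\vdash n}\sigma(\lambda,i,j)\,c_\lambda(T),$$ where $F_T(x,y)=\sum_{H}x^{|V(H)|}y^{d(V(H))}$ (sum over all subtrees $H$ of $T$), $c_\lambda(T)$ is the coefficient of $p_\lambda$ in the power-sum expansion of the chromatic symmetric function $X_T$, and $$\sigma(\lambda,i,j)=(-1)^{n-j-1}\binom{n-i-l(\lambda)+1}{j-l(\lambda)+1}\left(\sum_{s=1}^{l(\lambda)}\delta(\lambda_s,i)\right).$$
   Context: A partition $\lambda\vdash n$ is a sequence $\lambda=(\lambda_1,\dots,\lambda_l)$ of positive integers with $\lambda_1\ge\dots\ge\lambda_l$ and $\sum_i\lambda_i=n$; $l(\lambda)=l$ is its number of parts. Here $\delta(a,b)=1$ if $a=b$ and $0$ otherwise, so $\sum_{s}\delta(\lambda_s,i)$ is the number of parts of $\lambda$ equal to $i$. A binomial coefficient $\binom{a}{b}$ with $b<0$ is $0$. (If $\lambda$ has no part equal to $i$ then $\sigma(\lambda,i,j)=0$; if it has one, then $n-i-l(\lambda)+1\ge 0$.) Subtrees of $T$ are nonempty connected subgraphs of $T$ (single vertices included). For $W\subseteq V(T)$, $d(W)$ denotes the number of edges of $T$ with exactly one endpoint in $W$. The chromatic symmetric function of a graph $G$ is $X_G=\sum_{\kappa}\prod_{v\in V(G)}x_{\kappa(v)}$, in commuting variables $x_1,x_2,\dots$, the sum being over all proper colorings $\kappa:V(G)\to\mathbb{Z}^+$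 of $G$. It is a symmetric function homogeneous of degree $|V(G)|$. With $p_k=\sum_{i\ge1}x_i^k$ and $p_\lambda=p_{\lambda_1}\cdots p_{\lambda_l}$, the set $\{p_\lambda:\lambda\vdash n\}$ is a basis of the $\mathbb{Q}$-vector space of symmetric functions homogeneous of degree $n$, and the rational numbers $c_\lambda(G)$ are defined by $X_G=\sum_{\lambda\vdash n}c_\lambda(G)p_\lambda$ with $n=|V(G)|$. -}

module Defs where

open import Level using (0ℓ)
open import Data.Nat as ℕ using (ℕ; zero; suc; _∸_; NonZero)
open import Data.Nat.Combinatorics using (_C_)
open import Data.Integer as ℤ using (ℤ; +_; -[1+_])
open import Data.Rational as ℚ using (ℚ; 0ℚ; 1ℚ)
open import Data.Rational.Literals using (fromℤ)
open import Data.Bool using (if_then_else_)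
open import Data.Fin as Fin using (Fin; zero; suc; inject₁; fromℕ)
import Data.Fin.Properties as Fin
open import Data.Fin.Subset using (Subset; inside; outside; _∈_; _∉_; Nonempty; ∣_∣)
open import Data.Fin.Subset.Properties using (_∈?_; nonempty?)
open import Data.List as List
  using (List; []; _∷_; map; foldr; filter; length; upTo; allFin;
         cartesianProduct; cartesianProductWith; concatMap)
open import Data.Nat.ListAction using (sum)
import Data.List.Membership.Propositional as List
open import Data.List.Relation.Unary.All as All using (All)
open import Data.List.Relation.Unary.Any using (here; there)
open import Data.List.Relation.Unary.Linked using (Linked; linked?)
open import Data.List.Membership.Propositional.Properties using (∈-allFin)
open import Data.Vec as Vec using (Vec; []; _∷_; replicate; lookup; toList; _[_]≔_)
open import Data.Vec.Properties using (≡-dec)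
open import Data.Product using (_×_; _,_; proj₁; proj₂; ∃-syntax)
open import Data.Product.Properties using () renaming (≡-dec to ×-≡-dec)
open import Data.Sum using (_⊎_; inj₁; inj₂)
open import Function.Definitions using (Injective)
open import Relation.Binary using (Rel; Decidable)
open import Relation.Binary.Construct.Closure.ReflexiveTransitive using (Star; ε; _◅_; _◅◅_)
open import Relation.Binary.PropositionalEquality using (_≡_; _≢_; refl)
open import Relation.Nullary using (Dec; ¬_; does)
open import Relation.Nullary.Decidable using (map′; _×-dec_; _⊎-dec_; _→-dec_; ¬?)

allVecs : ∀ {A : Set} → List A → ∀ n → List (Vec A n)
allVecs as zero    = [] ∷ []
allVecs as (suc n) = cartesianProductWith _∷_ as (allVecs as n)

subsets : ∀ n → List (Subset n)
subsets = allVecs (inside ∷ outside ∷ [])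

infixr 5 ∑ℚ

∑ℚ : ∀ {A : Set} → List A → (A → ℚ) → ℚ
∑ℚ as f = foldr (λ a s → f a ℚ.+ s) 0ℚ as

syntax ∑ℚ as (λ a → e) = ∑ℚ[ a ← as ] e

------------------------------------------------------------------------
-- Formal power series over ℚ in x₀, …, x_{N-1}: the value at m is the
-- coefficient of the monomial x₀^(m₀) ⋯ x_{N-1}^(m_{N-1}).

Exponent : ℕ → Set
Exponent N = Vec ℕ N

Series : ℕ → Set
Series N = Exponent N → ℚ

infix  4 _≈_
infixl 6 _⊕_
infixl 7 _⊗_
infixr 7 _•_
infixr 8 _↑_
infixr 5 ∑ ∏

_≈_ : ∀ {N} → Series N → Series N → Set
f ≈ g = ∀ m → f m ≡ g m

𝟘 : ∀ {N} → Series N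
𝟘 _ = 0ℚ

_⊕_ : ∀ {N} → Series N → Series N → Series N
(f ⊕ g) m = f m ℚ.+ g m

_•_ : ∀ {N} → ℚ → Series N → Series N
(q • f) m = q ℚ.* f m

-- All pairs (a , b) with a + b ≡ m, each listed once.
splittings : ∀ {N} → Exponent N → List (Exponent N × Exponent N)
splittings []      = ([] , []) ∷ []
splittings (k ∷ m) =
  cartesianProductWith (λ { i (a , b) → (i ∷ a) , ((k ∸ i) ∷ b) })
                       (upTo (suc k)) (splittings m)

_⊗_ : ∀ {N} → Series N → Series N → Series N
(f ⊗ g) m = ∑ℚ[ ab ← splittings m ] (f (proj₁ ab) ℚ.* g (proj₂ ab))

monomial : ∀ {N} → Exponent N → Series N
monomial a m = if does (≡-dec ℕ._≟_ a m) then 1ℚ else 0ℚ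

𝟙 : ∀ {N} → Series N
𝟙 {N} = monomial (replicate N 0)

var : ∀ {N} → Fin N → Series N
var {N} i = monomial (replicate N 0 [ i ]≔ 1)

_↑_ : ∀ {N} → Series N → ℕ → Series N
f ↑ zero  = 𝟙
f ↑ suc k = f ⊗ (f ↑ k)

∑ : ∀ {N} {A : Set} → List A → (A → Series N) → Series N
∑ as f = foldr (λ a s → f a ⊕ s) 𝟘 as

∏ : ∀ {N} {A : Set} → List A → (A → Series N) → Series N
∏ as f = foldr (λ a s → f a ⊗ s) 𝟙 as

syntax ∑ as (λ a → e) = ∑[ a ← as ] e
syntax ∏ as (λ a → e) = ∏[ a ← as ] e

------------------------------------------------------------------------
-- Partitions

IsPartition : ℕ → List ℕ → Set
IsPartition n λs = All (ℕ._<_ 0) λs × Linked ℕ._≥_ λs × sum λs ≡ n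

isPartition? : ∀ n λs → Dec (IsPartition n λs)
isPartition? n λs =
  All.all? (ℕ._<?_ 0) λs ×-dec linked? ℕ._≥?_ λs ×-dec (sum λs ℕ.≟ n)

-- A partition of n has at most n parts, each at most n, so filtering the
-- lists of length ≤ n with entries ≤ n finds every partition exactly once.
partitions : ℕ → List (List ℕ)
partitions n =
  filter (isPartition? n)
         (concatMap (λ l → map toList (allVecs (upTo (suc n)) l)) (upTo (suc n)))

------------------------------------------------------------------------
-- Finite simple graphs and trees

record Graph (n : ℕ) : Set₁ where
  infix 4 _~_ _~?_
  field
    _~_      : Rel (Fin n) 0ℓ
    _~?_     : Decidable _~_
    ~-sym    : ∀ {u v} → u ~ v → v ~ u
    ~-irrefl : ∀ {v} → ¬ (v ~ v)

  -- Each edge {u , v} is listed once, as the pair with u < v.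
  edges : List (Fin n × Fin n)
  edges = filter (λ { (u , v) → (u Fin.<? v) ×-dec (u ~? v) })
                 (cartesianProduct (allFin n) (allFin n))

  Connected : Set
  Connected = ∀ u v → Star _~_ u v

  -- A cycle on k + 3 distinct vertices.
  IsCycle : ∀ {k} → (Fin (3 ℕ.+ k) → Fin n) → Set
  IsCycle {k} c = Injective _≡_ _≡_ c
                × (∀ i → c (inject₁ i) ~ c (suc i))
                × c (fromℕ (2 ℕ.+ k)) ~ c zero

  Acyclic : Set
  Acyclic = ∀ {k} (c : Fin (3 ℕ.+ k) → Fin n) → ¬ IsCycle c

  d : Subset n → ℕ
  d W = length (filter crosses? edges)
    where
    crosses? : ∀ e → Dec ((proj₁ e ∈ W × proj₂ e ∉ W) ⊎ (proj₁ e ∉ W × proj₂ e ∈ W))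
    crosses? (u , v) = ((u ∈? W) ×-dec ¬? (v ∈? W)) ⊎-dec (¬? (u ∈? W) ×-dec (v ∈? W))

record IsTree {n} (G : Graph n) : Set where
  open Graph G
  field
    nonempty  : NonZero n
    connected : Connected
    acyclic   : Acyclic

------------------------------------------------------------------------
-- Reachability in a finite graph is decidable (Floyd–Warshall).

module Reachability {n} {R : Rel (Fin n) 0ℓ} (R? : Decidable R) where

  -- Reachability with all intermediate vertices in the given list.
  Via : List (Fin n) → Rel (Fin n) 0ℓ
  Via []       u v = u ≡ v ⊎ R u v
  Via (w ∷ ws) u v = Via ws u v ⊎ (Via ws u w × Via ws w v)

  via? : ∀ ws → Decidable (Via ws)
  via? []       u v = (u Fin.≟ v) ⊎-dec R? u v
  via? (w ∷ ws) u v = via? ws u v ⊎-dec (via? ws u w ×-dec via? ws w v)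

  sound : ∀ ws {u v} → Via ws u v → Star R u v
  sound []       (inj₁ refl)    = ε
  sound []       (inj₂ r)       = r ◅ ε
  sound (w ∷ ws) (inj₁ p)       = sound ws p
  sound (w ∷ ws) (inj₂ (p , q)) = sound ws p ◅◅ sound ws q

  direct : ∀ ws {u v} → u ≡ v ⊎ R u v → Via ws u v
  direct []       p = p
  direct (_ ∷ ws) p = inj₁ (direct ws p)

  private
    to : ∀ {x ws u} → Via (x ∷ ws) u x → Via ws u x
    to (inj₁ p)       = p
    to (inj₂ (p , _)) = p

    from : ∀ {x ws v} → Via (x ∷ ws) x v → Via ws x v
    from (inj₁ p)       = p
    from (inj₂ (_ , p)) = p

  join : ∀ {ws u v w} → w List.∈ ws → Via ws u w → Via ws w v → Via ws u v
  join {x ∷ ws} (here refl) p q = inj₂ (to {ws = ws} p , from {ws = ws} q)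
  join {x ∷ ws} (there i) (inj₁ p)       (inj₁ q)       = inj₁ (join i p q)
  join {x ∷ ws} (there i) (inj₁ p)       (inj₂ (q , r)) = inj₂ (join i p q , r)
  join {x ∷ ws} (there i) (inj₂ (p , q)) (inj₁ r)       = inj₂ (p , join i q r)
  join {x ∷ ws} (there i) (inj₂ (p , _)) (inj₂ (_ , s)) = inj₂ (p , s)

  complete : ∀ {u v} → Star R u v → Via (allFin n) u v
  complete ε       = direct (allFin n) (inj₁ refl)
  complete (r ◅ p) = join (∈-allFin _) (direct (allFin n) (inj₂ r)) (complete p)

  star? : Decidable (Star R)
  star? u v = map′ (sound (allFin n)) complete (via? (allFin n) u v)

------------------------------------------------------------------------
-- Subtrees and the polynomial F_T

module _ {n} (T : Graph n) where
  open Graph T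

  -- A set of vertices together with a set of edges, the latter given by
  -- positions in `edges`.
  VertexEdgeSets : Set
  VertexEdgeSets = Subset n × Subset (length edges)

  IsSubgraph : VertexEdgeSets → Set
  IsSubgraph (V , E) =
    ∀ e → e ∈ E → proj₁ (List.lookup edges e) ∈ V × proj₂ (List.lookup edges e) ∈ V

  Joined : VertexEdgeSets → Rel (Fin n) 0ℓ
  Joined (V , E) u v =
    ∃[ e ] (e ∈ E × (List.lookup edges e ≡ (u , v) ⊎ List.lookup edges e ≡ (v , u)))

  IsSubtree : VertexEdgeSets → Set
  IsSubtree H@(V , E) =
    IsSubgraph H × Nonempty V × (∀ u v → u ∈ V → v ∈ V → Star (Joined H) u v)

  joined? : ∀ H → Decidable (Joined H)
  joined? (V , E) u v =
    Fin.any? λ e → (e ∈? E) ×-dec ((List.lookup edges e ≟ (u , v)) ⊎-dec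
                                   (List.lookup edges e ≟ (v , u)))
    where _≟_ = ×-≡-dec Fin._≟_ Fin._≟_

  isSubtree? : ∀ H → Dec (IsSubtree H)
  isSubtree? H@(V , E) =
    (Fin.all? λ e → (e ∈? E) →-dec
       ((proj₁ (List.lookup edges e) ∈? V) ×-dec (proj₂ (List.lookup edges e) ∈? V)))
    ×-dec nonempty? V
    ×-dec (Fin.all? λ u → Fin.all? λ v →
       (u ∈? V) →-dec ((v ∈? V) →-dec Reachability.star? (joined? H) u v))

  subtrees : List VertexEdgeSets
  subtrees = filter isSubtree? (cartesianProduct (subsets n) (subsets (length edges)))

x y : Series 2
x = var zero
y = var (suc zero)

F : ∀ {n} → Graph n → Series 2
F T = ∑[ H ← subtrees T ] (x ↑ ∣ proj₁ H ∣ ⊗ y ↑ Graph.d T (proj₁ H))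

------------------------------------------------------------------------
-- Chromatic symmetric functions.  A symmetric function in countably many
-- variables is given by the family, over all N, of the series in the first
-- N variables obtained by setting the remaining ones to zero.  Every
-- monomial involves finitely many variables, so this family determines the
-- function, and equality for all N is equality of all coefficients.

module _ {n} (G : Graph n) where
  open Graph G

  IsProper : ∀ {N} → Vec (Fin N) n → Set
  IsProper κ = ∀ u v → u ~ v → lookup κ u ≢ lookup κ v

  isProper? : ∀ {N} (κ : Vec (Fin N) n) → Dec (IsProper κ)
  isProper? κ = Fin.all? λ u → Fin.all? λ v →
    (u ~? v) →-dec ¬? (lookup κ u Fin.≟ lookup κ v)

  -- Setting x_i = 0 for i ≥ N leaves the colorings with colors below N.
  X : ∀ N → Series N
  X N = ∑[ κ ← filter isProper? (allVecs (allFin N) n) ]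
          (∏[ v ← allFin n ] var (lookup κ v))

powerSum : ∀ N → ℕ → Series N
powerSum N k = ∑[ i ← allFin N ] (var i ↑ k)

p : ∀ N → List ℕ → Series N
p N λs = ∏[ k ← λs ] powerSum N k

-- c is the family of coefficients of X_G in the basis p_λ, λ ⊢ n.  Only the
-- values of c at partitions of n matter.
IsPowerSumExpansion : ∀ {n} → Graph n → (List ℕ → ℚ) → Set
IsPowerSumExpansion {n} G c =
  ∀ N → X G N ≈ ∑[ λs ← partitions n ] (c λs • p N λs)

------------------------------------------------------------------------
-- The coefficients σ(λ, i, j)

-- binomial a b = 0 for b < 0.  For negative upper index this is
-- a (a - 1) ⋯ (a - b + 1) / b!, using (-1-a choose b) = (-1)^b (a + b choose b).
binomial : ℤ → ℤ → ℤ
binomial _        -[1+ _ ] = + 0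
binomial (+ a)    (+ b)    = + (a C b)
binomial -[1+ a ] (+ b)    = (ℤ.-1ℤ ℤ.^ b) ℤ.* + ((a ℕ.+ b) C b)

δ : ℕ → ℕ → ℕ
δ a b = if does (a ℕ.≟ b) then 1 else 0

-- The truncated exponent n ∸ j ∸ 1 is exact whenever j < n, which holds for
-- all 1 ≤ i ≤ n and j ≤ n - i.
σ : ℕ → List ℕ → ℕ → ℕ → ℚ
σ n λs i j = fromℤ
  ( (ℤ.-1ℤ ℤ.^ (n ∸ j ∸ 1))
  ℤ.* binomial (+ n ℤ.- + i ℤ.- + l ℤ.+ + 1) (+ j ℤ.- + l ℤ.+ + 1)
  ℤ.* + sum (map (λ part → δ part i) λs) )
  where l = length λs

-- Colour T with M colours of weight t and z colours of weight 1. Rooting T and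
-- summing out the colours from the leaves, for a fixed set W of vertices with
-- colours of the first kind, turns X_T into
--   ∑_W t^|W| M^c (M-1)^(|W|-c) z^c′ (z-1)^(n-|W|-c′),
-- where c and c′ are the numbers of components of W and of its complement,
-- while p_λ becomes ∏_s (M t^(λ_s) + z). The coefficient of M t^i keeps on the
-- left the connected sets W of size i, with sign (-1)^(i-1), and on the right
-- ∑_λ c_λ z^(l(λ)-1) ∑_s δ(λ_s,i). For connected W, c′ is the number of edges
-- leaving W, so that division by (z-1)^(n-i) makes the left side a polynomial in
-- z/(z-1) whose coefficients count subtrees; those of
-- z^(l-1)/(z-1)^(n-i) are the binomial coefficients in σ.
-- Coefficients are extracted by finite combinations of values at integers.
module Submission where

open import Algebra using (CommutativeRing)
open import Data.Bool as Bool using (Bool; true; false; if_then_else_; _∧_; not)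
import Data.Bool.Properties as Bool
open import Data.Empty using (⊥; ⊥-elim)
open import Data.Fin as Fin using (Fin; zero; suc; inject₁; fromℕ; opposite)
import Data.Fin.Properties as Fin
open import Data.Fin.Properties using (injective⇒≤; opposite-involutive)
open import Data.Fin.Subset as Subset using (Subset; inside; outside; Nonempty; ∣_∣)
open import Data.Fin.Subset.Properties using (_∈?_; nonempty?; ⊆-antisym)
open import Data.Integer as ℤ using (ℤ)
import Data.Integer.Properties as ℤ
open import Data.List as List
  using (List; []; _∷_; _++_; map; filter; length; upTo; allFin; tabulate;
         cartesianProduct; cartesianProductWith; concatMap)
open import Data.List.Membership.DecPropositional using () renaming (_∈?_ to _∈?[_]_)
open import Data.List.Membership.Propositional using (_∈_; _∉_)
open import Data.List.Membership.Propositional.Properties as ∈ using (∈-allFin)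
open import Data.List.Membership.Propositional.Properties.WithK using (unique∧set⇒bag)
import Data.List.Properties as List
open import Data.List.Relation.Binary.BagAndSetEquality using (∼bag⇒↭)
open import Data.List.Relation.Binary.Permutation.Propositional as Perm using (_↭_)
open import Data.List.Relation.Binary.Permutation.Propositional.Properties
  using (↭-length; map⁺; filter-↭)
import Data.List.Relation.Unary.All as All
open import Data.List.Relation.Unary.All using (All; []; _∷_)
open import Data.List.Relation.Unary.AllPairs using ([]; _∷_)
import Data.List.Relation.Unary.Any as Any
open import Data.List.Relation.Unary.Any using (here; there)
open import Data.List.Relation.Unary.Any.Properties using (lookup-index)
open import Data.List.Relation.Unary.Unique.Propositional using (Unique)
import Data.List.Relation.Unary.Unique.Propositional.Properties as Unique
open import Data.Nat as ℕ using (ℕ; zero; suc; _∸_; z≤n; s≤s)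
open import Data.Nat.Combinatorics using (_C_; nCk+nC[k+1]≡[n+1]C[k+1])
open import Data.Nat.ListAction using (sum)
open import Data.Nat.ListAction.Properties using (sum-↭)
import Data.Nat.Properties as ℕ
open import Data.Product using (_×_; _,_; proj₁; proj₂; ∃-syntax; uncurry)
open import Data.Rational as ℚ using (ℚ; 0ℚ; 1ℚ; _+_; _*_; -_; _-_)
open import Data.Rational.Literals using (fromℤ)
import Data.Rational.Properties as ℚ
open import Data.Rational.Solver using (module +-*-Solver)
open import Data.Sum using (_⊎_; inj₁; inj₂; [_,_]′)
open import Data.Vec as Vec using (Vec; []; _∷_; lookup; replicate; zipWith; _[_]≔_)
import Data.Vec.Properties as Vec
open import Function using (_∘_; id)
open import Function.Bundles using (mk⇔)
open import Function.Definitions using (Injective)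
open import Level using (0ℓ)
open import Relation.Binary using (Rel; DecidableEquality)
open import Relation.Binary.Construct.Closure.ReflexiveTransitive using (Star; ε; _◅_; _◅◅_)
open import Relation.Binary.PropositionalEquality
  using (_≡_; _≢_; refl; sym; trans; cong; cong₂; subst; subst₂; module ≡-Reasoning)
open import Relation.Nullary using (Dec; yes; no; does; ¬_; contradiction)
open import Relation.Nullary.Decidable using (dec-true; dec-false; does-⇔; ¬?; _×-dec_)
open import Algebra.Properties.CommutativeSemiring.Exp (CommutativeRing.commutativeSemiring ℚ.+-*-commutativeRing)
  using (_^_; ^-homo-*)
open import Defs
open ≡-Reasoning

-- The expansion of X_T gives one identity for each number of variables, so M and z are natural
-- numbers and the two-type identity is available only at integer points. Each coefficient is
-- therefore read off by a linear functional that samples at positive integers and is specified by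
-- its moments up to a degree bound. Division by (z-1)^(n-i), impossible at z = 1, also disappears:
-- on polynomials of degree at most D = n-i the products z^a (z-1)^b with a + b = D form a basis,
-- and the functional is one coordinate in it. After the growth, the tree is used through a list of
-- child-parent pairs in order of attachment. Components on either side of W are counted by the
-- vertices without a parent on their own side. The root is one of these and every cut edge adds
-- exactly one more, so c + c′ = 1 + d(W), and c = 1 turns c′ into d(W). The same list shows that a
-- subtree is determined by its vertex set: deleting any one pair separates its two ends.

private
  variable
    A B E : Set
    n N : ℕ

-- Finite sums and products

ind : Bool → ℚ
ind b = if b then 1ℚ else 0ℚ

ind-∧ : ∀ b c → ind (b ∧ c) ≡ ind b * ind c
ind-∧ false c = sym (ℚ.*-zeroˡ (ind c))
ind-∧ true  c = sym (ℚ.*-identityˡ (ind c))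

opaque
  -- ∑ℚ unfolds during unification, which keeps Agda from inferring the summand.
  ⅀ : List A → (A → ℚ) → ℚ
  ⅀ = ∑ℚ

  infixr 5 ⅀
  syntax ⅀ as (λ a → e) = ⅀[ a ← as ] e

  ∑ℚ≡⅀ : ∀ (as : List A) f → ∑ℚ as f ≡ ⅀ as f
  ∑ℚ≡⅀ as f = refl

  ∑-[] : ∀ (f : A → ℚ) → ⅀ [] f ≡ 0ℚ
  ∑-[] f = refl

  ∑-∷ : ∀ a (as : List A) f → ⅀ (a ∷ as) f ≡ f a + ⅀ as f
  ∑-∷ a as f = refl

  ∑-cong-∈ : ∀ (as : List A) {f g : A → ℚ} → (∀ {a} → a ∈ as → f a ≡ g a) → ⅀ as f ≡ ⅀ as g
  ∑-cong-∈ []       f≗g = refl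
  ∑-cong-∈ (a ∷ as) f≗g = cong₂ _+_ (f≗g (here refl)) (∑-cong-∈ as (f≗g ∘ there))

  ∑-cong : ∀ (as : List A) {f g : A → ℚ} → (∀ a → f a ≡ g a) → ⅀ as f ≡ ⅀ as g
  ∑-cong as f≗g = ∑-cong-∈ as (λ {a} _ → f≗g a)

  ∑-zero : ∀ (as : List A) → ⅀ as (λ _ → 0ℚ) ≡ 0ℚ
  ∑-zero []       = refl
  ∑-zero (_ ∷ as) = trans (ℚ.+-identityˡ _) (∑-zero as)

  ∑-++ : ∀ (as bs : List A) f → ⅀ (as ++ bs) f ≡ ⅀ as f + ⅀ bs f
  ∑-++ []       bs f = sym (ℚ.+-identityˡ _)
  ∑-++ (a ∷ as) bs f = trans (cong (f a +_) (∑-++ as bs f)) (sym (ℚ.+-assoc (f a) _ _))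

  ∑-map : ∀ (h : A → B) as f → ⅀ (map h as) f ≡ ⅀ as (f ∘ h)
  ∑-map h []       f = refl
  ∑-map h (a ∷ as) f = cong (f (h a) +_) (∑-map h as f)

  ∑-+ : ∀ (as : List A) f g → ⅀ as (λ a → f a + g a) ≡ ⅀ as f + ⅀ as g
  ∑-+ []       f g = refl
  ∑-+ (a ∷ as) f g = trans (cong (f a + g a +_) (∑-+ as f g))
    (solve 4 (λ a b c d → (a :+ b) :+ (c :+ d) := (a :+ c) :+ (b :+ d)) refl (f a) (g a) _ _)
    where open +-*-Solver

  *-∑ : ∀ q (as : List A) f → q * ⅀ as f ≡ ⅀ as (λ a → q * f a)
  *-∑ q []       f = ℚ.*-zeroʳ q
  *-∑ q (a ∷ as) f = trans (ℚ.*-distribˡ-+ q (f a) _) (cong (q * f a +_) (*-∑ q as f))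

  ∑-* : ∀ q (as : List A) f → ⅀ as f * q ≡ ⅀ as (λ a → f a * q)
  ∑-* q as f = trans (ℚ.*-comm _ q) (trans (*-∑ q as f) (∑-cong as λ a → ℚ.*-comm q (f a)))

  ∑-swap : ∀ (as : List A) (bs : List B) (f : A → B → ℚ) →
           ⅀[ a ← as ] ⅀[ b ← bs ] f a b ≡ ⅀[ b ← bs ] ⅀[ a ← as ] f a b
  ∑-swap []       bs f = sym (∑-zero bs)
  ∑-swap (a ∷ as) bs f = trans (cong (⅀ bs (f a) +_) (∑-swap as bs f)) (sym (∑-+ bs (f a) _))

  ∑-× : ∀ (as : List A) (bs : List B) f g →
        ⅀ as f * ⅀ bs g ≡ ⅀[ a ← as ] ⅀[ b ← bs ] f a * g b
  ∑-× as bs f g = trans (∑-* _ as f) (∑-cong as λ a → *-∑ (f a) bs g)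

  ∑-filter : ∀ {P : A → Set} (P? : ∀ a → Dec (P a)) as f →
             ⅀ (filter P? as) f ≡ ⅀[ a ← as ] ind (does (P? a)) * f a
  ∑-filter P? []       f = refl
  ∑-filter P? (a ∷ as) f with does (P? a)
  ... | true  = cong₂ _+_ (sym (ℚ.*-identityˡ (f a))) (∑-filter P? as f)
  ... | false = trans (∑-filter P? as f)
                      (sym (trans (cong (_+ _) (ℚ.*-zeroˡ (f a))) (ℚ.+-identityˡ _)))

  ∑-cartesianProductWith : ∀ (h : A → B → E) as bs (f : E → ℚ) →
    ⅀ (cartesianProductWith h as bs) f ≡ ⅀[ a ← as ] ⅀[ b ← bs ] f (h a b)
  ∑-cartesianProductWith h []       bs f = refl
  ∑-cartesianProductWith h (a ∷ as) bs f =
    trans (∑-++ (map (h a) bs) _ f)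
          (cong₂ _+_ (∑-map (h a) bs f) (∑-cartesianProductWith h as bs f))

  -- Uniqueness of the list keeps the Kronecker delta from picking its term more than once.
  ∑-select : ∀ (_≟_ : DecidableEquality A) {as a} → Unique as → a ∈ as → ∀ (f : A → ℚ) →
             ⅀[ b ← as ] ind (does (a ≟ b)) * f b ≡ f a
  ∑-select _≟_ {b ∷ as} {a} (b∉ ∷ _) (here refl) f = begin
    ind (does (a ≟ b)) * f b + ⅀ as (λ c → ind (does (a ≟ c)) * f c)
      ≡⟨ cong₂ _+_ (cong (λ t → ind t * f b) (dec-true (a ≟ b) refl))
                   (∑-cong-∈ as λ {c} c∈ → trans
                      (cong (λ t → ind t * f c) (dec-false (a ≟ c) (All.lookup b∉ c∈)))
                      (ℚ.*-zeroˡ (f c))) ⟩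
    1ℚ * f b + ⅀ as (λ _ → 0ℚ)
      ≡⟨ cong₂ _+_ (ℚ.*-identityˡ (f b)) (∑-zero as) ⟩
    f b + 0ℚ
      ≡⟨ ℚ.+-identityʳ (f b) ⟩
    f b ∎
  ∑-select _≟_ {b ∷ as} {a} (b∉ ∷ u) (there a∈) f =
    trans (cong₂ _+_ (trans (cong (λ t → ind t * f b)
                               (dec-false (a ≟ b) λ { refl → All.lookup b∉ a∈ refl }))
                            (ℚ.*-zeroˡ (f b)))
                     (∑-select _≟_ u a∈ f))
          (ℚ.+-identityˡ (f a))

∏ℚ : List A → (A → ℚ) → ℚ
∏ℚ []       f = 1ℚ
∏ℚ (a ∷ as) f = f a * ∏ℚ as f

∏-cong : ∀ (as : List A) {f g : A → ℚ} → (∀ a → f a ≡ g a) → ∏ℚ as f ≡ ∏ℚ as g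
∏-cong []       f≗g = refl
∏-cong (a ∷ as) f≗g = cong₂ _*_ (f≗g a) (∏-cong as f≗g)

∏-↭ : ∀ {as bs : List A} f → as ↭ bs → ∏ℚ as f ≡ ∏ℚ bs f
∏-↭ f Perm.refl          = refl
∏-↭ f (Perm.prep a π)    = cong (f a *_) (∏-↭ f π)
∏-↭ f (Perm.swap a b π)  = trans (cong (λ s → f a * (f b * s)) (∏-↭ f π))
  (solve 3 (λ a b s → a :* (b :* s) := b :* (a :* s)) refl (f a) (f b) _)
  where open +-*-Solver
∏-↭ f (Perm.trans π₁ π₂) = trans (∏-↭ f π₁) (∏-↭ f π₂)

allVecs-unique : ∀ {as : List A} → Unique as → ∀ n → Unique (allVecs as n)
allVecs-unique u zero    = [] ∷ []
allVecs-unique u (suc n) =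
  Unique.cartesianProductWith⁺ _∷_ Vec.∷-injective u (allVecs-unique u n)

∈-allVecs : ∀ {as : List A} (v : Vec A n) → (∀ i → lookup v i ∈ as) → v ∈ allVecs as n
∈-allVecs []      v∈ = here refl
∈-allVecs (a ∷ v) v∈ = ∈.∈-cartesianProductWith⁺ _∷_ (v∈ zero) (∈-allVecs v (v∈ ∘ suc))

-- Substitution into X_G and p_λ

∑-at : ∀ (as : List A) (f : A → Series N) m → ∑ as f m ≡ ⅀[ a ← as ] f a m
∑-at []       f m = sym (∑-[] _)
∑-at (a ∷ as) f m = trans (cong (f a m +_) (∑-at as f m)) (sym (∑-∷ a as _))

weight : (Fin N → ℚ) → Exponent N → ℚ
weight w []      = 1ℚ
weight w (k ∷ m) = w zero ^ k * weight (w ∘ suc) m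

weight-0 : ∀ (w : Fin N → ℚ) → weight w (replicate N 0) ≡ 1ℚ
weight-0 {zero}  w = refl
weight-0 {suc N} w = trans (ℚ.*-identityˡ _) (weight-0 (w ∘ suc))

weight-var : ∀ (w : Fin N → ℚ) i → weight w (replicate N 0 [ i ]≔ 1) ≡ w i
weight-var w zero    = trans (cong₂ _*_ (ℚ.*-identityʳ (w zero)) (weight-0 (w ∘ suc))) (ℚ.*-identityʳ (w zero))
weight-var w (suc i) = trans (ℚ.*-identityˡ _) (weight-var (w ∘ suc) i)

weight-+ : ∀ (w : Fin N → ℚ) a b → weight w (zipWith ℕ._+_ a b) ≡ weight w a * weight w b
weight-+ w []      []      = refl
weight-+ w (i ∷ a) (j ∷ b) =
  trans (cong₂ _*_ (^-homo-* (w zero) i j) (weight-+ (w ∘ suc) a b))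
    (solve 4 (λ p q r s → (p :* q) :* (r :* s) := (p :* r) :* (q :* s)) refl
       (w zero ^ i) (w zero ^ j) (weight (w ∘ suc) a) (weight (w ∘ suc) b))
  where open +-*-Solver

-- One-variable case of `monomial-⊗`: only i = a can contribute, and then k ∸ a = b says a + b = k
-- because a ≤ k makes the subtraction exact. For a > k no index is reached.
∑-splittings : ∀ a b k → ⅀[ i ← upTo (suc k) ] ind (does (a ℕ.≟ i)) * ind (does (b ℕ.≟ k ∸ i))
                         ≡ ind (does (a ℕ.+ b ℕ.≟ k))
∑-splittings a b k with a ℕ.≤? k
... | yes a≤k = trans
  (∑-select ℕ._≟_ (Unique.upTo⁺ (suc k)) (∈.∈-upTo⁺ (s≤s a≤k)) (λ i → ind (does (b ℕ.≟ k ∸ i))))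
  (cong ind (does-⇔ (mk⇔ (λ { refl → ℕ.m+[n∸m]≡n a≤k }) (λ { refl → sym (ℕ.m+n∸m≡n a b) }))
                     (b ℕ.≟ k ∸ a) (a ℕ.+ b ℕ.≟ k)))
... | no a≰k = trans
  (∑-cong-∈ (upTo (suc k)) λ {i} i∈ → trans
     (cong (λ t → ind t * ind (does (b ℕ.≟ k ∸ i)))
           (dec-false (a ℕ.≟ i) λ { refl → a≰k (ℕ.≤-pred (∈.∈-upTo⁻ i∈)) }))
     (ℚ.*-zeroˡ (ind (does (b ℕ.≟ k ∸ i)))))
  (trans (∑-zero (upTo (suc k)))
         (sym (cong ind (dec-false (a ℕ.+ b ℕ.≟ k) λ { refl → a≰k (ℕ.m≤m+n a b) }))))

monomial-∷ : ∀ i k (a m : Exponent N) →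
             monomial (i ∷ a) (k ∷ m) ≡ ind (does (i ℕ.≟ k)) * monomial a m
monomial-∷ i k a m = ind-∧ (does (i ℕ.≟ k)) _

monomial-⊗ : ∀ (a b : Exponent N) → monomial a ⊗ monomial b ≈ monomial (zipWith ℕ._+_ a b)
monomial-⊗ []      []      []      = refl
monomial-⊗ (i ∷ a) (j ∷ b) (k ∷ m) = begin
  (monomial (i ∷ a) ⊗ monomial (j ∷ b)) (k ∷ m)
    ≡⟨ trans (∑ℚ≡⅀ (splittings (k ∷ m)) (λ ab → monomial (i ∷ a) (proj₁ ab) * monomial (j ∷ b) (proj₂ ab)))
             (∑-cartesianProductWith _ (upTo (suc k)) (splittings m) _) ⟩
  ⅀ (upTo (suc k)) (λ h → ⅀ (splittings m) (λ ab →
     monomial (i ∷ a) (h ∷ proj₁ ab) * monomial (j ∷ b) ((k ∸ h) ∷ proj₂ ab)))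
    ≡⟨ ∑-cong (upTo (suc k)) (λ h → ∑-cong (splittings m) λ ab → trans
         (cong₂ _*_ (monomial-∷ i h a (proj₁ ab)) (monomial-∷ j (k ∸ h) b (proj₂ ab)))
         (solve 4 (λ p q r s → (p :* q) :* (r :* s) := (p :* r) :* (q :* s)) refl
            (ind (does (i ℕ.≟ h))) (monomial a (proj₁ ab))
            (ind (does (j ℕ.≟ k ∸ h))) (monomial b (proj₂ ab)))) ⟩
  ⅀ (upTo (suc k)) (λ h → ⅀ (splittings m) (λ ab →
     (ind (does (i ℕ.≟ h)) * ind (does (j ℕ.≟ k ∸ h)))
     * (monomial a (proj₁ ab) * monomial b (proj₂ ab))))
    ≡⟨ sym (∑-× (upTo (suc k)) (splittings m) _ _) ⟩
  ⅀ (upTo (suc k)) (λ h → ind (does (i ℕ.≟ h)) * ind (does (j ℕ.≟ k ∸ h)))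
  * ⅀ (splittings m) (λ ab → monomial a (proj₁ ab) * monomial b (proj₂ ab))
    ≡⟨ cong₂ _*_ (∑-splittings i j k)
         (trans (sym (∑ℚ≡⅀ (splittings m) _)) (monomial-⊗ a b m)) ⟩
  ind (does (i ℕ.+ j ℕ.≟ k)) * monomial (zipWith ℕ._+_ a b) m
    ≡⟨ sym (monomial-∷ (i ℕ.+ j) k (zipWith ℕ._+_ a b) m) ⟩
  monomial ((i ℕ.+ j) ∷ zipWith ℕ._+_ a b) (k ∷ m) ∎
  where open +-*-Solver

sum-replicate-0 : ∀ N → Vec.sum (replicate N 0) ≡ 0
sum-replicate-0 zero    = refl
sum-replicate-0 (suc N) = sum-replicate-0 N

sum-var : ∀ (i : Fin N) → Vec.sum (replicate N 0 [ i ]≔ 1) ≡ 1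
sum-var {suc N} zero    = cong suc (sum-replicate-0 N)
sum-var         (suc i) = sum-var i

sum-zipWith-+ : ∀ (a b : Exponent N) → Vec.sum (zipWith ℕ._+_ a b) ≡ Vec.sum a ℕ.+ Vec.sum b
sum-zipWith-+ []      []      = refl
sum-zipWith-+ (i ∷ a) (j ∷ b) = trans (cong (i ℕ.+ j ℕ.+_) (sum-zipWith-+ a b))
  (solve 4 (λ p q r s → (p :+ q) :+ (r :+ s) := (p :+ r) :+ (q :+ s)) refl i j (Vec.sum a) (Vec.sum b))
  where
  open import Data.Nat.Solver using () renaming (module +-*-Solver to ℕ-Solver)
  open ℕ-Solver

-- Substitution makes no sense for an arbitrary series. The finite list of monomials, repetitions
-- allowed, certifies that `f` is a homogeneous polynomial of degree `k` whose value at `w` is `q`.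
record Evaluates (w : Fin N → ℚ) (k : ℕ) (f : Series N) (q : ℚ) : Set where
  field
    terms     : List (Exponent N)
    expansion : ∀ m → f m ≡ ⅀[ a ← terms ] monomial a m
    degree    : ∀ {a} → a ∈ terms → Vec.sum a ≡ k
    value     : ⅀ terms (weight w) ≡ q

open Evaluates

module _ {N : ℕ} (w : Fin N → ℚ) where

  eval-monomial : ∀ a → Evaluates w (Vec.sum a) (monomial a) (weight w a)
  eval-monomial a .terms            = a ∷ []
  eval-monomial a .expansion m      = sym (trans (∑-∷ a [] _) (trans (cong (monomial a m +_) (∑-[] _)) (ℚ.+-identityʳ _)))
  eval-monomial a .degree (here eq) = cong Vec.sum eq
  eval-monomial a .value            = trans (∑-∷ a [] _) (trans (cong (weight w a +_) (∑-[] _)) (ℚ.+-identityʳ _))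

  eval-𝟙 : Evaluates w 0 𝟙 1ℚ
  eval-𝟙 = subst₂ (λ k q → Evaluates w k 𝟙 q) (sum-replicate-0 N) (weight-0 w)
                  (eval-monomial (replicate N 0))

  eval-var : ∀ i → Evaluates w 1 (var i) (w i)
  eval-var i = subst₂ (λ k q → Evaluates w k (var i) q) (sum-var i) (weight-var w i)
                      (eval-monomial (replicate N 0 [ i ]≔ 1))

  eval-𝟘 : ∀ k → Evaluates w k 𝟘 0ℚ
  eval-𝟘 k .terms       = []
  eval-𝟘 k .expansion m = sym (∑-[] _)
  eval-𝟘 k .degree      = λ ()
  eval-𝟘 k .value       = ∑-[] _

  eval-⊕ : ∀ {k f g q r} → Evaluates w k f q → Evaluates w k g r → Evaluates w k (f ⊕ g) (q + r)
  eval-⊕ ef eg .terms       = ef .terms ++ eg .terms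
  eval-⊕ ef eg .expansion m =
    trans (cong₂ _+_ (ef .expansion m) (eg .expansion m)) (sym (∑-++ (ef .terms) (eg .terms) _))
  eval-⊕ ef eg .degree a∈   = [ ef .degree , eg .degree ]′ (∈.∈-++⁻ (ef .terms) a∈)
  eval-⊕ ef eg .value       =
    trans (∑-++ (ef .terms) (eg .terms) _) (cong₂ _+_ (ef .value) (eg .value))

  eval-⊗ : ∀ {k l f g q r} → Evaluates w k f q → Evaluates w l g r →
           Evaluates w (k ℕ.+ l) (f ⊗ g) (q * r)
  eval-⊗ ef eg .terms = cartesianProductWith (zipWith ℕ._+_) (ef .terms) (eg .terms)
  eval-⊗ {f = f} {g} ef eg .expansion m = begin
    (f ⊗ g) m
      ≡⟨ ∑ℚ≡⅀ (splittings m) _ ⟩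
    ⅀ (splittings m) (λ ab → f (proj₁ ab) * g (proj₂ ab))
      ≡⟨ ∑-cong (splittings m) (λ ab → trans
           (cong₂ _*_ (ef .expansion (proj₁ ab)) (eg .expansion (proj₂ ab)))
           (∑-× (ef .terms) (eg .terms) _ _)) ⟩
    ⅀ (splittings m) (λ ab → ⅀ (ef .terms) (λ a → ⅀ (eg .terms) (λ b →
       monomial a (proj₁ ab) * monomial b (proj₂ ab))))
      ≡⟨ ∑-swap (splittings m) (ef .terms) _ ⟩
    ⅀ (ef .terms) (λ a → ⅀ (splittings m) (λ ab → ⅀ (eg .terms) (λ b →
       monomial a (proj₁ ab) * monomial b (proj₂ ab))))
      ≡⟨ ∑-cong (ef .terms) (λ a → trans
           (∑-swap (splittings m) (eg .terms) _)
           (∑-cong (eg .terms) λ b → trans (sym (∑ℚ≡⅀ (splittings m) _)) (monomial-⊗ a b m))) ⟩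
    ⅀ (ef .terms) (λ a → ⅀ (eg .terms) (λ b → monomial (zipWith ℕ._+_ a b) m))
      ≡⟨ sym (∑-cartesianProductWith _ (ef .terms) (eg .terms) _) ⟩
    ⅀ (cartesianProductWith (zipWith ℕ._+_) (ef .terms) (eg .terms)) (λ a → monomial a m) ∎
  eval-⊗ ef eg .degree c∈
    with a , b , a∈ , b∈ , refl ← ∈.∈-cartesianProductWith⁻ (zipWith ℕ._+_) (ef .terms) (eg .terms) c∈
    = trans (sum-zipWith-+ a b) (cong₂ ℕ._+_ (ef .degree a∈) (eg .degree b∈))
  eval-⊗ {q = q} {r} ef eg .value = begin
    ⅀ (cartesianProductWith (zipWith ℕ._+_) (ef .terms) (eg .terms)) (weight w)
      ≡⟨ ∑-cartesianProductWith _ (ef .terms) (eg .terms) _ ⟩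
    ⅀ (ef .terms) (λ a → ⅀ (eg .terms) (λ b → weight w (zipWith ℕ._+_ a b)))
      ≡⟨ ∑-cong (ef .terms) (λ a → ∑-cong (eg .terms) λ b → weight-+ w a b) ⟩
    ⅀ (ef .terms) (λ a → ⅀ (eg .terms) (λ b → weight w a * weight w b))
      ≡⟨ sym (∑-× (ef .terms) (eg .terms) _ _) ⟩
    ⅀ (ef .terms) (weight w) * ⅀ (eg .terms) (weight w)
      ≡⟨ cong₂ _*_ (ef .value) (eg .value) ⟩
    q * r ∎

  eval-↑ : ∀ i k → Evaluates w k (var i ↑ k) (w i ^ k)
  eval-↑ i zero    = eval-𝟙
  eval-↑ i (suc k) = eval-⊗ (eval-var i) (eval-↑ i k)

  eval-∑ : ∀ (as : List A) {f : A → Series N} {q k} → (∀ a → Evaluates w k (f a) (q a)) →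
           Evaluates w k (∑ as f) (⅀ as q)
  eval-∑ []       ef = subst (Evaluates w _ 𝟘) (sym (∑-[] _)) (eval-𝟘 _)
  eval-∑ (a ∷ as) ef = subst (Evaluates w _ _) (sym (∑-∷ a as _)) (eval-⊕ (ef a) (eval-∑ as ef))

  eval-∏ : ∀ (as : List A) {f : A → Series N} {q} {k : A → ℕ} → (∀ a → Evaluates w (k a) (f a) (q a)) →
           Evaluates w (sum (map k as)) (∏ as f) (∏ℚ as q)
  eval-∏ []       ef = eval-𝟙
  eval-∏ (a ∷ as) ef = eval-⊗ (ef a) (eval-∏ as ef)

  -- Uses nothing but coefficients, so that a coefficientwise equality of series carries over. The
  -- box of exponents up to `n` contains every monomial of degree `n`.
  substitute : ℕ → Series N → ℚ
  substitute n f = ⅀[ m ← allVecs (upTo (suc n)) N ] f m * weight w m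

  substitute-eval : ∀ {f q} → Evaluates w n f q → substitute n f ≡ q
  substitute-eval {n} {f} {q} ef = begin
    ⅀ box (λ m → f m * weight w m)
      ≡⟨ ∑-cong box (λ m → trans (cong (_* weight w m) (ef .expansion m))
                                  (∑-* (weight w m) (ef .terms) _)) ⟩
    ⅀ box (λ m → ⅀ (ef .terms) (λ a → monomial a m * weight w m))
      ≡⟨ ∑-swap box (ef .terms) _ ⟩
    ⅀ (ef .terms) (λ a → ⅀ box (λ m → monomial a m * weight w m))
      ≡⟨ ∑-cong-∈ (ef .terms) (λ {a} a∈ → ∑-select (Vec.≡-dec ℕ._≟_)
           (allVecs-unique (Unique.upTo⁺ (suc n)) N)
           (∈-allVecs a λ i → ∈.∈-upTo⁺ (s≤s (ℕ.≤-trans (lookup≤sum a i) (ℕ.≤-reflexive (ef .degree a∈)))))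
           (weight w)) ⟩
    ⅀ (ef .terms) (weight w)
      ≡⟨ ef .value ⟩
    q ∎
    where
    box = allVecs (upTo (suc n)) N
    lookup≤sum : ∀ {N} (a : Exponent N) i → lookup a i ℕ.≤ Vec.sum a
    lookup≤sum (k ∷ a) zero    = ℕ.m≤m+n k _
    lookup≤sum (k ∷ a) (suc i) = ℕ.≤-trans (lookup≤sum a i) (ℕ.m≤n+m _ k)

partitions-sound : ∀ n {λs} → λs ∈ partitions n → IsPartition n λs
partitions-sound n λs∈ = proj₂ (∈.∈-filter⁻ (isPartition? n)
  {xs = concatMap (λ l → map Vec.toList (allVecs (upTo (suc n)) l)) (upTo (suc n))} λs∈)

-- Both sides of the expansion are homogeneous of degree `n`: a colouring contributes one variable
-- per vertex, and the parts of a partition of `n` add up to `n`. Hence `substitute` gives their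
-- true values at `w`.
substitute-expansion : ∀ (G : Graph n) c → IsPowerSumExpansion G c → ∀ {N} (w : Fin N → ℚ) →
  ⅀[ κ ← allVecs (allFin N) n ] ind (does (isProper? G κ)) * ∏ℚ (allFin n) (w ∘ lookup κ)
  ≡ ⅀[ λs ← partitions n ] c λs * ∏ℚ λs (λ k → ⅀ (allFin N) (λ i → w i ^ k))
substitute-expansion {n} G c X≈ {N} w = begin
  ⅀[ κ ← allVecs (allFin N) n ] ind (does (isProper? G κ)) * ∏ℚ (allFin n) (w ∘ lookup κ)
    ≡⟨ sym (∑-filter (isProper? G) (allVecs (allFin N) n) _) ⟩
  ⅀[ κ ← filter (isProper? G) (allVecs (allFin N) n) ] ∏ℚ (allFin n) (w ∘ lookup κ)
    ≡⟨ sym (substitute-eval w (eval-∑ w (filter (isProper? G) (allVecs (allFin N) n)) λ κ →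
         subst (λ k → Evaluates w k (∏ (allFin n) (var ∘ lookup κ)) (∏ℚ (allFin n) (w ∘ lookup κ))) (sum-ones n)
               (eval-∏ w (allFin n) {k = λ _ → 1} λ v → eval-var w (lookup κ v)))) ⟩
  substitute w n (X G N)
    ≡⟨ ∑-cong box (λ m → trans
         (cong (_* weight w m) (trans (X≈ N m) (∑-at (partitions n) (λ λs → c λs • p N λs) m)))
         (∑-* (weight w m) (partitions n) (λ λs → c λs * p N λs m))) ⟩
  ⅀ box (λ m → ⅀ (partitions n) (λ λs → c λs * p N λs m * weight w m))
    ≡⟨ ∑-swap box (partitions n) _ ⟩
  ⅀ (partitions n) (λ λs → ⅀ box (λ m → c λs * p N λs m * weight w m))
    ≡⟨ ∑-cong-∈ (partitions n) (λ {λs} λs∈ → trans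
         (trans (∑-cong box λ m → ℚ.*-assoc (c λs) (p N λs m) (weight w m))
                (sym (*-∑ (c λs) box _)))
         (cong (c λs *_) (substitute-eval w (subst (λ k → Evaluates w k (p N λs) _)
           (trans (cong sum (List.map-id λs)) (proj₂ (proj₂ (partitions-sound n λs∈))))
           (eval-∏ w λs {k = id} λ k → eval-∑ w (allFin N) λ i → eval-↑ w i k))))) ⟩
  ⅀[ λs ← partitions n ] c λs * ∏ℚ λs (λ k → ⅀ (allFin N) (λ i → w i ^ k)) ∎
  where
  box = allVecs (upTo (suc n)) N
  sum-ones : ∀ n → sum (map (λ _ → 1) (allFin n)) ≡ n
  sum-ones n = trans (go (allFin n)) (List.length-tabulate {n = n} id)
    where
    go : ∀ (vs : List (Fin n)) → sum (map (λ _ → 1) vs) ≡ length vs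
    go []       = refl
    go (_ ∷ vs) = cong suc (go vs)

-- Linear functionals with prescribed moments

-- Recursive, so that `ι (suc m)` unfolds to `1ℚ + ι m`; `fromℤ-+` reconciles it with the embedding
-- used in `σ`.
ι : ℕ → ℚ
ι zero    = 0ℚ
ι (suc m) = 1ℚ + ι m

ι-+ : ∀ m k → ι (m ℕ.+ k) ≡ ι m + ι k
ι-+ zero    k = sym (ℚ.+-identityˡ (ι k))
ι-+ (suc m) k = trans (cong (1ℚ +_) (ι-+ m k)) (sym (ℚ.+-assoc 1ℚ (ι m) (ι k)))

ι-nonNegative : ∀ m → 0ℚ ℚ.≤ ι m
ι-nonNegative zero    = ℚ.≤-refl
ι-nonNegative (suc m) = ℚ.+-mono-≤ (ℚ.nonNegative⁻¹ 1ℚ) (ι-nonNegative m)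

ι-suc≢0 : ∀ m → ι (suc m) ≢ 0ℚ
ι-suc≢0 m eq = ℚ.<⇒≢ (ℚ.+-mono-<-≤ (ℚ.positive⁻¹ 1ℚ) (ι-nonNegative m)) (sym eq)

ι-suc⁻¹ : ℕ → ℚ
ι-suc⁻¹ m = ℚ.1/_ (ι (suc m)) {{ℚ.≢-nonZero (ι-suc≢0 m)}}

ι-suc-inverseˡ : ∀ m → ι-suc⁻¹ m * ι (suc m) ≡ 1ℚ
ι-suc-inverseˡ m = ℚ.*-inverseˡ (ι (suc m)) {{ℚ.≢-nonZero (ι-suc≢0 m)}}

-- A finite combination ∑ aₑ · f(s + e) of values of f at integers ≥ s.
Functional : Set
Functional = List (ℚ × ℕ)

evaluate : ℕ → Functional → (ℕ → ℚ) → ℚ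
evaluate s J f = ⅀[ ae ← J ] proj₁ ae * f (s ℕ.+ proj₂ ae)

-- Any moments up to a given degree can be prescribed (invertibility of the
-- Vandermonde matrix): on multiples of x - s the value at s plays no role,
-- and it is used to adjust the moment of degree 0.
moments : ∀ D (r : ℕ → ℚ) s →
          ∃[ J ] (∀ k → k ℕ.≤ D → evaluate s J (λ m → ι m ^ k) ≡ r k)
moments zero r s = (r 0 , 0) ∷ [] , λ { zero _ →
  trans (∑-∷ (r 0 , 0) [] _) (trans (cong (r 0 * 1ℚ +_) (∑-[] _))
        (trans (ℚ.+-identityʳ _) (ℚ.*-identityʳ (r 0)))) }
-- These are the values required on (x - s) x^k, one moment fewer. They are realised at the points
-- from s + 1 on, where x - s is invertible.
moments (suc D) r s with J' , J'-moments ← moments D (λ k → r (suc k) - ι s * r k) (suc s) =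
  J , J-moments
  where
  open +-*-Solver
  -- At the point s + (e + 1) the factor x - s equals e + 1; dividing the coefficient by it makes
  -- the new functional act on (x - s) f as `J'` acts on f.
  shift : ℚ × ℕ → ℚ × ℕ
  shift (a , e) = a * ι-suc⁻¹ e , suc e
  rest : ℚ
  rest = evaluate s (map shift J') (λ _ → 1ℚ)
  J : Functional
  J = (r 0 - rest , 0) ∷ map shift J'
  factor : ∀ k ae → proj₁ (shift ae) * ι (s ℕ.+ proj₂ (shift ae)) ^ suc k
    ≡ ι s * (proj₁ (shift ae) * ι (s ℕ.+ proj₂ (shift ae)) ^ k)
      + proj₁ ae * ι (suc s ℕ.+ proj₂ ae) ^ k
  factor k (a , e) rewrite ℕ.+-suc s e = begin
    a * i * (t * t ^ k)
      ≡⟨ cong (λ t′ → a * i * (t′ * t ^ k)) (trans (cong ι (sym (ℕ.+-suc s e))) (ι-+ s (suc e))) ⟩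
    a * i * ((ι s + ι (suc e)) * t ^ k)
      ≡⟨ solve 5 (λ a i s u p → a :* i :* ((s :+ u) :* p) := s :* (a :* i :* p) :+ a :* (i :* u) :* p)
           refl a i (ι s) (ι (suc e)) (t ^ k) ⟩
    ι s * (a * i * t ^ k) + a * (i * ι (suc e)) * t ^ k
      ≡⟨ cong (λ q → ι s * (a * i * t ^ k) + q * t ^ k)
           (trans (cong (a *_) (ι-suc-inverseˡ e)) (ℚ.*-identityʳ a)) ⟩
    ι s * (a * i * t ^ k) + a * t ^ k ∎
    where
    i = ι-suc⁻¹ e
    t = ι (suc (s ℕ.+ e))
  J-moments : ∀ k → k ℕ.≤ suc D → evaluate s J (λ m → ι m ^ k) ≡ r k
  J-moments zero _ = trans (∑-∷ _ (map shift J') _)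
    (solve 2 (λ a b → (a :- b) :* con 1ℚ :+ b := a) refl (r 0) rest)
  J-moments (suc k) (s≤s k≤D) = begin
    evaluate s J (λ m → ι m ^ suc k)
      ≡⟨ trans (∑-∷ _ (map shift J') _) (cong (h * ι (s ℕ.+ 0) ^ suc k +_) (∑-map shift J' _)) ⟩
    h * ι (s ℕ.+ 0) ^ suc k + ⅀ J' (λ ae → proj₁ (shift ae) * ι (s ℕ.+ proj₂ (shift ae)) ^ suc k)
      ≡⟨ cong₂ _+_ (cong (λ t → h * (ι t * ι (s ℕ.+ 0) ^ k)) (ℕ.+-identityʳ s))
                   (trans (∑-cong J' (factor k)) (trans (∑-+ J' _ _)
                     (cong₂ _+_ (sym (*-∑ (ι s) J' _)) (J'-moments k k≤D)))) ⟩
    h * (ι s * ι (s ℕ.+ 0) ^ k)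
      + (ι s * ⅀ J' (λ ae → proj₁ (shift ae) * ι (s ℕ.+ proj₂ (shift ae)) ^ k)
         + (r (suc k) - ι s * r k))
      ≡⟨ solve 6 (λ h s p w r′ r → h :* (s :* p) :+ (s :* w :+ (r′ :- s :* r))
                    := s :* (h :* p :+ w) :+ (r′ :- s :* r)) refl
           h (ι s) (ι (s ℕ.+ 0) ^ k) _ (r (suc k)) (r k) ⟩
    ι s * (h * ι (s ℕ.+ 0) ^ k + ⅀ J' (λ ae → proj₁ (shift ae) * ι (s ℕ.+ proj₂ (shift ae)) ^ k))
      + (r (suc k) - ι s * r k)
      ≡⟨ cong (λ q → ι s * q + (r (suc k) - ι s * r k)) (trans
           (sym (trans (∑-∷ _ (map shift J') _) (cong (h * ι (s ℕ.+ 0) ^ k +_) (∑-map shift J' _))))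
           (J-moments k (ℕ.m≤n⇒m≤1+n k≤D))) ⟩
    ι s * r k + (r (suc k) - ι s * r k)
      ≡⟨ solve 3 (λ s r r′ → s :* r :+ (r′ :- s :* r) := r′) refl (ι s) (r k) (r (suc k)) ⟩
    r (suc k) ∎
    where h = r 0 - rest

opaque
  -- Sampling starts at 1 because the two-type identity is stated for `suc M` colours of the first
  -- kind, which guarantees that a colour exists.
  apply : Functional → (ℕ → ℚ) → ℚ
  apply = evaluate 1

  apply-moments : ∀ D (r : ℕ → ℚ) → ∃[ J ] (∀ k → k ℕ.≤ D → apply J (λ m → ι m ^ k) ≡ r k)
  apply-moments D r = moments D r 1

  apply-cong : ∀ J {f g : ℕ → ℚ} → (∀ e → f (suc e) ≡ g (suc e)) → apply J f ≡ apply J g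
  apply-cong J f≗g = ∑-cong J λ ae → cong (proj₁ ae *_) (f≗g (proj₂ ae))

  apply-* : ∀ J q f → apply J (λ m → q * f m) ≡ q * apply J f
  apply-* J q f = trans
    (∑-cong J λ ae → solve 3 (λ a q f → a :* (q :* f) := q :* (a :* f)) refl (proj₁ ae) q (f (suc (proj₂ ae))))
    (sym (*-∑ q J _))
    where open +-*-Solver

  apply-+ : ∀ J f g → apply J (λ m → f m + g m) ≡ apply J f + apply J g
  apply-+ J f g = trans (∑-cong J λ ae → ℚ.*-distribˡ-+ (proj₁ ae) _ _) (∑-+ J _ _)

  apply-∑ : ∀ J (as : List A) (f : A → ℕ → ℚ) →
            apply J (λ m → ⅀[ a ← as ] f a m) ≡ ⅀[ a ← as ] apply J (f a)
  apply-∑ J as f = trans (∑-cong J λ ae → *-∑ (proj₁ ae) as _) (∑-swap J as _)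

apply-- : ∀ J f g → apply J (λ m → f m - g m) ≡ apply J f - apply J g
apply-- J f g = trans
  (apply-cong J λ e → solve 2 (λ f g → f :- g := f :+ :- con 1ℚ :* g) refl (f (suc e)) (g (suc e)))
  (trans (apply-+ J f (λ m → - 1ℚ * g m)) (cong (apply J f +_) (trans (apply-* J (- 1ℚ) g)
    (solve 1 (λ q → :- con 1ℚ :* q := :- q) refl (apply J g)))))
  where open +-*-Solver

-- The coefficient of the first power

module _ (n : ℕ) where

  -- On polynomials of degree at most `n` these moments describe the coefficient of m.
  linearPart-moments : ∃[ J ] (∀ k → k ℕ.≤ n → apply J (λ m → ι m ^ k) ≡ ind (does (k ℕ.≟ 1)))
  linearPart-moments = apply-moments n (λ k → ind (does (k ℕ.≟ 1)))

  linearPart : Functional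
  linearPart = proj₁ linearPart-moments

  linearPart-^ : ∀ k → k ℕ.≤ n → apply linearPart (λ m → ι m ^ k) ≡ ind (does (k ℕ.≟ 1))
  linearPart-^ = proj₂ linearPart-moments

  -- The linear term of m^(c+1) (m-1)^a needs c = 0 and is then m times the constant term (-1)^a.
  -- The induction trades a factor m - 1 for a difference of two products whose degrees stay within
  -- `n`.
  linearPart-falling : ∀ c a → suc c ℕ.+ a ℕ.≤ n →
    apply linearPart (λ m → ι m ^ suc c * (ι m - 1ℚ) ^ a) ≡ ind (does (suc c ℕ.≟ 1)) * (- 1ℚ) ^ a
  linearPart-falling c zero c≤n = trans
    (apply-cong linearPart λ e → ℚ.*-identityʳ (ι (suc e) ^ suc c))
    (trans (linearPart-^ (suc c) (subst (ℕ._≤ n) (ℕ.+-identityʳ _) c≤n)) (sym (ℚ.*-identityʳ _)))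
  linearPart-falling c (suc a) c+a≤n = begin
    L (λ m → ι m ^ suc c * (ι m - 1ℚ) ^ suc a)
      ≡⟨ apply-cong linearPart (λ e → solve 3 (λ m p q → m :* p :* ((m :- con 1ℚ) :* q)
           := m :* (m :* p) :* q :- m :* p :* q) refl (ι (suc e)) (ι (suc e) ^ c) ((ι (suc e) - 1ℚ) ^ a)) ⟩
    L (λ m → ι m ^ suc (suc c) * (ι m - 1ℚ) ^ a - ι m ^ suc c * (ι m - 1ℚ) ^ a)
      ≡⟨ apply-- linearPart _ _ ⟩
    L (λ m → ι m ^ suc (suc c) * (ι m - 1ℚ) ^ a) - L (λ m → ι m ^ suc c * (ι m - 1ℚ) ^ a)
      ≡⟨ cong₂ _-_ (linearPart-falling (suc c) a (subst (ℕ._≤ n) (ℕ.+-suc (suc c) a) c+a≤n))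
                   (linearPart-falling c a (ℕ.≤-trans (ℕ.+-monoʳ-≤ (suc c) (ℕ.n≤1+n a)) c+a≤n)) ⟩
    -- `suc (suc c) ≟ 1` reduces to a negative answer, hence the literal `0ℚ`.
    0ℚ * (- 1ℚ) ^ a - ind (does (suc c ℕ.≟ 1)) * (- 1ℚ) ^ a
      ≡⟨ solve 2 (λ i q → con 0ℚ :* q :- i :* q := i :* (:- con 1ℚ :* q)) refl
           (ind (does (suc c ℕ.≟ 1))) ((- 1ℚ) ^ a) ⟩
    ind (does (suc c ℕ.≟ 1)) * (- 1ℚ) ^ suc a ∎
    where
    open +-*-Solver
    L = apply linearPart

  module _ (z t : ℚ) where

    ∏-linear : ℚ → List ℕ → ℚ
    ∏-linear m ks = ∏ℚ ks (λ k → m * t ^ k + z)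

    linearPart-^-∏ : ∀ c ks → suc c ℕ.+ length ks ℕ.≤ n →
      apply linearPart (λ m → ι m ^ suc c * ∏-linear (ι m) ks)
      ≡ ind (does (suc c ℕ.≟ 1)) * z ^ length ks
    linearPart-^-∏ c [] c≤n = trans
      (apply-cong linearPart λ e → ℚ.*-identityʳ (ι (suc e) ^ suc c))
      (trans (linearPart-^ (suc c) (subst (ℕ._≤ n) (ℕ.+-identityʳ _) c≤n)) (sym (ℚ.*-identityʳ _)))
    linearPart-^-∏ c (k ∷ ks) c+l≤n = begin
      L (λ m → ι m ^ suc c * ((ι m * t ^ k + z) * ∏-linear (ι m) ks))
        ≡⟨ apply-cong linearPart (λ e → solve 5 (λ m p q z r → m :* p :* ((m :* q :+ z) :* r)
             := q :* (m :* (m :* p) :* r) :+ z :* (m :* p :* r)) refl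
             (ι (suc e)) (ι (suc e) ^ c) (t ^ k) z (∏-linear (ι (suc e)) ks)) ⟩
      L (λ m → t ^ k * (ι m ^ suc (suc c) * ∏-linear (ι m) ks) + z * (ι m ^ suc c * ∏-linear (ι m) ks))
        ≡⟨ trans (apply-+ linearPart (λ m → t ^ k * (ι m ^ suc (suc c) * ∏-linear (ι m) ks))
                                    (λ m → z * (ι m ^ suc c * ∏-linear (ι m) ks)))
                 (cong₂ _+_ (apply-* linearPart (t ^ k) (λ m → ι m ^ suc (suc c) * ∏-linear (ι m) ks))
                            (apply-* linearPart z (λ m → ι m ^ suc c * ∏-linear (ι m) ks))) ⟩
      t ^ k * L (λ m → ι m ^ suc (suc c) * ∏-linear (ι m) ks) + z * L (λ m → ι m ^ suc c * ∏-linear (ι m) ks)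
        ≡⟨ cong₂ (λ p q → t ^ k * p + z * q)
             (linearPart-^-∏ (suc c) ks (subst (ℕ._≤ n) (ℕ.+-suc (suc c) _) c+l≤n))
             (linearPart-^-∏ c ks (ℕ.≤-trans (ℕ.+-monoʳ-≤ (suc c) (ℕ.n≤1+n _)) c+l≤n)) ⟩
      t ^ k * (0ℚ * z ^ length ks) + z * (ind (does (suc c ℕ.≟ 1)) * z ^ length ks)
        ≡⟨ solve 4 (λ q p i z → q :* (con 0ℚ :* p) :+ z :* (i :* p) := i :* (z :* p)) refl
             (t ^ k) (z ^ length ks) (ind (does (suc c ℕ.≟ 1))) z ⟩
      ind (does (suc c ℕ.≟ 1)) * z ^ length (k ∷ ks) ∎
      where
      open +-*-Solver
      L = apply linearPart

    -- The product rule at m = 0: one factor supplies its t^k, each of the others its constant term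
    -- z.
    linearPart-∏ : ∀ ks → length ks ℕ.≤ n →
      apply linearPart (λ m → ∏-linear (ι m) ks) ≡ ⅀[ k ← ks ] t ^ k * z ^ (length ks ∸ 1)
    linearPart-∏ []       _   = trans (linearPart-^ 0 z≤n) (sym (∑-[] _))
    linearPart-∏ (k ∷ ks) l≤n = begin
      L (λ m → (ι m * t ^ k + z) * ∏-linear (ι m) ks)
        ≡⟨ apply-cong linearPart (λ e → solve 4 (λ m q z r → (m :* q :+ z) :* r
             := q :* (m :* con 1ℚ :* r) :+ z :* r) refl (ι (suc e)) (t ^ k) z (∏-linear (ι (suc e)) ks)) ⟩
      L (λ m → t ^ k * (ι m ^ 1 * ∏-linear (ι m) ks) + z * ∏-linear (ι m) ks)
        ≡⟨ trans (apply-+ linearPart (λ m → t ^ k * (ι m ^ 1 * ∏-linear (ι m) ks)) (λ m → z * ∏-linear (ι m) ks))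
                 (cong₂ _+_ (apply-* linearPart (t ^ k) (λ m → ι m ^ 1 * ∏-linear (ι m) ks))
                            (apply-* linearPart z (λ m → ∏-linear (ι m) ks))) ⟩
      t ^ k * L (λ m → ι m ^ 1 * ∏-linear (ι m) ks) + z * L (λ m → ∏-linear (ι m) ks)
        ≡⟨ cong₂ (λ p q → t ^ k * p + z * q)
             (trans (linearPart-^-∏ 0 ks l≤n) (ℚ.*-identityˡ _))
             (linearPart-∏ ks (ℕ.≤-trans (ℕ.n≤1+n _) l≤n)) ⟩
      t ^ k * z ^ length ks + z * (⅀[ k ← ks ] t ^ k * z ^ (length ks ∸ 1))
        ≡⟨ cong (t ^ k * z ^ length ks +_) (rest ks) ⟩
      t ^ k * z ^ length ks + (⅀[ k ← ks ] t ^ k * z ^ length ks)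
        ≡⟨ sym (∑-∷ k ks _) ⟩
      ⅀[ k ← k ∷ ks ] t ^ k * z ^ length ks ∎
      where
      open +-*-Solver
      L = apply linearPart
      -- For the empty list `length ks ∸ 1` truncates, but then both sums are 0.
      rest : ∀ ks → z * (⅀[ k ← ks ] t ^ k * z ^ (length ks ∸ 1)) ≡ ⅀[ k ← ks ] t ^ k * z ^ length ks
      rest []           = trans (cong (z *_) (∑-[] _)) (trans (ℚ.*-zeroʳ z) (sym (∑-[] _)))
      rest ks@(_ ∷ ks′) = trans (*-∑ z ks _) (∑-cong ks λ k →
        solve 3 (λ z q p → z :* (q :* p) := q :* (z :* p)) refl z (t ^ k) (z ^ length ks′))

-- N choose j - k, which is 0 for k > j.
choose : ℕ → ℕ → ℕ → ℕ
choose N j       zero    = N C j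
choose N zero    (suc k) = 0
choose N (suc j) (suc k) = choose N j k

choose-pascal : ∀ N j k → choose (suc N) j k ≡ choose N j (suc k) ℕ.+ choose N j k
choose-pascal N zero    zero    = refl
choose-pascal N (suc j) zero    = sym (nCk+nC[k+1]≡[n+1]C[k+1] N j)
choose-pascal N zero    (suc k) = refl
choose-pascal N (suc j) (suc k) = choose-pascal N j k

choose-0 : ∀ j k → ι (choose 0 j k) ≡ ind (does (k ℕ.≟ j))
choose-0 zero    zero    = refl
choose-0 (suc j) zero    = refl
choose-0 zero    (suc k) = refl
choose-0 (suc j) (suc k) = choose-0 j k

[-1]^k*[-1]^k : ∀ k → (- 1ℚ) ^ k * (- 1ℚ) ^ k ≡ 1ℚ
[-1]^k*[-1]^k zero    = refl
[-1]^k*[-1]^k (suc k) = trans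
  (solve 1 (λ p → (:- con 1ℚ :* p) :* (:- con 1ℚ :* p) := p :* p) refl ((- 1ℚ) ^ k)) ([-1]^k*[-1]^k k)
  where open +-*-Solver

-- Dividing a polynomial in x of degree ≤ D by (x-1)^D gives a polynomial in
-- x/(x-1), and the functional picks the coefficient of its j-th power.
module _ (D j : ℕ) where

  -- Write x^k as x^k (x - (x-1))^(D-k) and expand: x^j (x-1)^(D-j) appears with the sign (-1)^(D-j)
  -- and the binomial coefficient D-k choose j-k. With k = l-1 and D = n-i this is the binomial
  -- coefficient of `σ`.
  homogeneousPart-moment : ℕ → ℚ
  homogeneousPart-moment k = (- 1ℚ) ^ (D ∸ j) * ι (choose (D ∸ k) j k)

  homogeneousPart-moments :
    ∃[ J ] (∀ k → k ℕ.≤ D → apply J (λ m → ι m ^ k) ≡ homogeneousPart-moment k)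
  homogeneousPart-moments = apply-moments D homogeneousPart-moment

  homogeneousPart : Functional
  homogeneousPart = proj₁ homogeneousPart-moments

  homogeneousPart-^ : ∀ k → k ℕ.≤ D → apply homogeneousPart (λ m → ι m ^ k) ≡ homogeneousPart-moment k
  homogeneousPart-^ = proj₂ homogeneousPart-moments

  -- The same expansion applied to the missing degree D-(a+b) only. Each further factor x - 1
  -- becomes a difference, and Pascal's rule cancels one of the two resulting terms.
  homogeneousPart-falling : ∀ a b → a ℕ.+ b ℕ.≤ D →
    apply homogeneousPart (λ m → ι m ^ a * (ι m - 1ℚ) ^ b)
    ≡ (- 1ℚ) ^ (D ∸ j) * ((- 1ℚ) ^ b * ι (choose (D ∸ (a ℕ.+ b)) j a))
  homogeneousPart-falling a zero a≤D rewrite ℕ.+-identityʳ a = begin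
    L (λ m → ι m ^ a * 1ℚ)
      ≡⟨ apply-cong homogeneousPart (λ e → ℚ.*-identityʳ (ι (suc e) ^ a)) ⟩
    L (λ m → ι m ^ a)
      ≡⟨ homogeneousPart-^ a a≤D ⟩
    (- 1ℚ) ^ (D ∸ j) * ι (choose (D ∸ a) j a)
      ≡⟨ cong ((- 1ℚ) ^ (D ∸ j) *_) (sym (ℚ.*-identityˡ _)) ⟩
    (- 1ℚ) ^ (D ∸ j) * (1ℚ * ι (choose (D ∸ a) j a)) ∎
    where L = apply homogeneousPart
  homogeneousPart-falling a (suc b) a+b≤D = begin
    L (λ m → ι m ^ a * (ι m - 1ℚ) ^ suc b)
      ≡⟨ apply-cong homogeneousPart (λ e → solve 3 (λ m p q → p :* ((m :- con 1ℚ) :* q)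
           := m :* p :* q :- p :* q) refl (ι (suc e)) (ι (suc e) ^ a) ((ι (suc e) - 1ℚ) ^ b)) ⟩
    L (λ m → ι m ^ suc a * (ι m - 1ℚ) ^ b - ι m ^ a * (ι m - 1ℚ) ^ b)
      ≡⟨ apply-- homogeneousPart _ _ ⟩
    L (λ m → ι m ^ suc a * (ι m - 1ℚ) ^ b) - L (λ m → ι m ^ a * (ι m - 1ℚ) ^ b)
      ≡⟨ cong₂ _-_ (homogeneousPart-falling (suc a) b 1+a+b≤D)
                   (homogeneousPart-falling a b (ℕ.<⇒≤ 1+a+b≤D)) ⟩
    u * (v * ι (choose D′ j (suc a))) - u * (v * ι (choose (D ∸ (a ℕ.+ b)) j a))
      ≡⟨ cong (λ q → u * (v * ι (choose D′ j (suc a))) - u * (v * q)) (trans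
           -- `suc D ∸ suc (a + b)` reduces to `D ∸ (a + b)`, so this exposes the upper index as
           -- `suc D′`, ready for Pascal's rule.
           (cong (λ k → ι (choose k j a)) (ℕ.+-∸-assoc 1 1+a+b≤D))
           (trans (cong ι (choose-pascal D′ j a)) (ι-+ (choose D′ j (suc a)) (choose D′ j a)))) ⟩
    u * (v * ι (choose D′ j (suc a))) - u * (v * (ι (choose D′ j (suc a)) + ι (choose D′ j a)))
      ≡⟨ solve 4 (λ u v p q → u :* (v :* p) :- u :* (v :* (p :+ q)) := u :* (:- con 1ℚ :* v :* q)) refl
           u v (ι (choose D′ j (suc a))) (ι (choose D′ j a)) ⟩
    u * ((- 1ℚ) ^ suc b * ι (choose D′ j a))
      ≡⟨ cong (λ k → u * ((- 1ℚ) ^ suc b * ι (choose (D ∸ k) j a))) (sym (ℕ.+-suc a b)) ⟩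
    u * ((- 1ℚ) ^ suc b * ι (choose (D ∸ (a ℕ.+ suc b)) j a)) ∎
    where
    open +-*-Solver
    L = apply homogeneousPart
    u = (- 1ℚ) ^ (D ∸ j)
    v = (- 1ℚ) ^ b
    D′ = D ∸ suc (a ℕ.+ b)
    1+a+b≤D : suc a ℕ.+ b ℕ.≤ D
    1+a+b≤D = subst (ℕ._≤ D) (ℕ.+-suc a b) a+b≤D

  -- With a + b = D the product is itself a member of the basis; for a = j the signs (-1)^(D-j) and
  -- (-1)^b agree and cancel.
  homogeneousPart-select : ∀ a b → a ℕ.+ b ≡ D →
    apply homogeneousPart (λ m → ι m ^ a * (ι m - 1ℚ) ^ b) ≡ ind (does (a ℕ.≟ j))
  homogeneousPart-select a b refl = begin
    apply homogeneousPart (λ m → ι m ^ a * (ι m - 1ℚ) ^ b)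
      ≡⟨ homogeneousPart-falling a b ℕ.≤-refl ⟩
    (- 1ℚ) ^ (D ∸ j) * ((- 1ℚ) ^ b * ι (choose (D ∸ D) j a))
      ≡⟨ cong (λ q → (- 1ℚ) ^ (D ∸ j) * ((- 1ℚ) ^ b * q))
           (trans (cong (λ k → ι (choose k j a)) (ℕ.n∸n≡0 D)) (choose-0 j a)) ⟩
    (- 1ℚ) ^ (D ∸ j) * ((- 1ℚ) ^ b * ind (does (a ℕ.≟ j)))
      ≡⟨ cancel (a ℕ.≟ j) ⟩
    ind (does (a ℕ.≟ j)) ∎
    where
    open +-*-Solver
    cancel : ∀ (a≟j : Dec (a ≡ j)) →
             (- 1ℚ) ^ (D ∸ j) * ((- 1ℚ) ^ b * ind (does a≟j)) ≡ ind (does a≟j)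
    cancel (yes refl) rewrite ℕ.m+n∸m≡n a b =
      trans (cong ((- 1ℚ) ^ b *_) (ℚ.*-identityʳ _)) ([-1]^k*[-1]^k b)
    cancel (no _) = solve 2 (λ p q → p :* (q :* con 0ℚ) := con 0ℚ) refl ((- 1ℚ) ^ (D ∸ j)) ((- 1ℚ) ^ b)

-- Growing a tree

lookup-injective : ∀ {xs : List A} → Unique xs → ∀ {i j} → List.lookup xs i ≡ List.lookup xs j → i ≡ j
lookup-injective (_ ∷ _)  {zero}  {zero}  _  = refl
lookup-injective (x∉ ∷ _) {zero}  {suc j} eq = contradiction eq (All.lookup x∉ (∈.∈-lookup j))
lookup-injective (x∉ ∷ _) {suc i} {zero}  eq = contradiction (sym eq) (All.lookup x∉ (∈.∈-lookup i))
lookup-injective (_ ∷ u)  {suc i} {suc j} eq = cong suc (lookup-injective u eq)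

vertices : Fin n → List (Fin n × Fin n) → List (Fin n)
vertices r []             = r ∷ []
vertices r ((v , _) ∷ ps) = v ∷ vertices r ps

opposite-inject₁ : ∀ {k} (i : Fin k) → opposite (inject₁ i) ≡ suc (opposite i)
opposite-inject₁ zero    = refl
opposite-inject₁ (suc i) = cong inject₁ (opposite-inject₁ i)

opposite-fromℕ : ∀ k → opposite (fromℕ k) ≡ zero
opposite-fromℕ zero    = refl
opposite-fromℕ (suc k) = cong inject₁ (opposite-fromℕ k)

module _ {n : ℕ} (T : Graph n) where
  open Graph T

  -- A simple path, encoded as an injective map from `Fin` so that closing it up yields an `IsCycle`
  -- directly.
  record Path (S : List (Fin n)) (u v : Fin n) : Set where
    field
      {size}    : ℕ
      at        : Fin (suc size) → Fin n
      injective : Injective _≡_ _≡_ at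
      adjacent  : ∀ i → at (inject₁ i) ~ at (suc i)
      start     : at zero ≡ u
      end       : at (fromℕ size) ≡ v
      stays     : ∀ i → at i ∈ S

  open Path

  singlePath : ∀ {S u} → u ∈ S → Path S u u
  singlePath {u = u} u∈S = record
    { at = λ (_ : Fin 1) → u
    ; injective = λ { {zero} {zero} _ → refl }
    ; adjacent = λ ()
    ; start = refl ; end = refl ; stays = λ _ → u∈S }

  weakenPath : ∀ {S x u v} → Path S u v → Path (x ∷ S) u v
  weakenPath P = record
    { at = P .at ; injective = P .injective ; adjacent = P .adjacent
    ; start = P .start ; end = P .end ; stays = there ∘ P .stays }

  consPath : ∀ {S x u v} → x ∉ S → x ~ u → Path S u v → Path (x ∷ S) x v
  consPath {x = x} x∉S x~u P = record
    { at = at′ ; injective = injective′ ; adjacent = adjacent′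
    ; start = refl ; end = P .end
    ; stays = λ { zero → here refl ; (suc i) → there (P .stays i) } }
    where
    at′ : Fin (suc (suc (P .size))) → Fin n
    at′ zero    = x
    at′ (suc i) = P .at i
    injective′ : Injective _≡_ _≡_ at′
    injective′ {zero}  {zero}  _    = refl
    injective′ {zero}  {suc j} refl = contradiction (P .stays j) x∉S
    injective′ {suc i} {zero}  refl = contradiction (P .stays i) x∉S
    injective′ {suc i} {suc j} eq   = cong suc (P .injective eq)
    adjacent′ : ∀ i → at′ (inject₁ i) ~ at′ (suc i)
    adjacent′ zero    = subst (x ~_) (sym (P .start)) x~u
    adjacent′ (suc i) = P .adjacent i

  reversePath : ∀ {S u v} → Path S u v → Path S v u
  reversePath P = record
    { at = P .at ∘ opposite
    ; injective = λ {i} {j} eq → trans (sym (opposite-involutive i))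
                    (trans (cong opposite (P .injective eq)) (opposite-involutive j))
    ; adjacent = λ i → subst (λ j → P .at j ~ P .at (inject₁ (opposite i)))
                             (sym (opposite-inject₁ i)) (~-sym (P .adjacent (opposite i)))
    ; start = P .end
    ; end = trans (cong (P .at) (opposite-fromℕ (P .size))) (P .start)
    ; stays = P .stays ∘ opposite }

  -- Each pair (v , u) attaches a new vertex v to its parent u, its only
  -- neighbour among the vertices present so far.
  data Grown (r : Fin n) : List (Fin n × Fin n) → Set where
    seed   : Grown r []
    attach : ∀ {ps v u} → Grown r ps → u ∈ vertices r ps → v ∉ vertices r ps → v ~ u →
             (∀ {u′} → u′ ∈ vertices r ps → v ~ u′ → u′ ≡ u) → Grown r ((v , u) ∷ ps)

  module _ {r : Fin n} where

    -- The newest vertex lies outside the older ones, so prepending it keeps a path simple. A path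
    -- that ends in it is built from that end and reversed.
    grown-path : ∀ {ps} → Grown r ps → ∀ {u v} → u ∈ vertices r ps → v ∈ vertices r ps →
                 Path (vertices r ps) u v
    grown-path seed (here refl) (here refl) = singlePath (here refl)
    grown-path (attach g _ _ _ _) (here refl) (here refl) = singlePath (here refl)
    grown-path (attach g w∈ x∉ x~w _) (here refl) (there v∈) =
      consPath x∉ x~w (grown-path g w∈ v∈)
    grown-path (attach g w∈ x∉ x~w _) (there u∈) (here refl) =
      reversePath (consPath x∉ x~w (grown-path g w∈ u∈))
    grown-path (attach g _ _ _ _) (there u∈) (there v∈) = weakenPath (grown-path g u∈ v∈)

    -- Two neighbours would close a cycle through v.
    unique-neighbour : Acyclic → ∀ {ps} → Grown r ps → ∀ {u u′ v} → u ∈ vertices r ps →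
      u′ ∈ vertices r ps → v ∉ vertices r ps → v ~ u → v ~ u′ → u′ ≡ u
    unique-neighbour acyclic {ps} g {u} {u′} {v} u∈ u′∈ v∉ v~u v~u′ =
      close (grown-path g u∈ u′∈)
      where
      close : Path (vertices r ps) u u′ → u′ ≡ u
      close record { size = zero ; start = refl ; end = refl } = refl
      -- With at least one edge between the two neighbours, the path extended by `v` has at least
      -- three vertices, as `IsCycle` demands.
      close P@record { size = suc k } = ⊥-elim (acyclic (Q .at)
        (Q .injective , Q .adjacent , subst₂ _~_ (sym (Q .end)) (sym (Q .start)) (~-sym v~u′)))
        where Q = consPath v∉ v~u P

    parent∈ : ∀ {ps} → Grown r ps → ∀ {v u} → (v , u) ∈ ps → u ∈ vertices r ps
    parent∈ (attach g u∈ _ _ _) (here refl) = there u∈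
    parent∈ (attach g _ _ _ _)  (there e∈)  = there (parent∈ g e∈)

    child∈ : ∀ {ps} → Grown r ps → ∀ {v u} → (v , u) ∈ ps → v ∈ vertices r ps
    child∈ (attach g _ _ _ _) (here refl) = here refl
    child∈ (attach g _ _ _ _) (there e∈)  = there (child∈ g e∈)

    grown-sound : ∀ {ps} → Grown r ps → ∀ {v u} → (v , u) ∈ ps → v ~ u
    grown-sound (attach g _ _ v~u _) (here refl) = v~u
    grown-sound (attach g _ _ _ _)   (there e∈)  = grown-sound g e∈

    -- A new vertex has a single older neighbour, so the pairs record every edge among the vertices
    -- present and not merely a spanning tree of them.
    grown-complete : ∀ {ps} → Grown r ps → ∀ {u v} → u ∈ vertices r ps → v ∈ vertices r ps →
                     u ~ v → (u , v) ∈ ps ⊎ (v , u) ∈ ps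
    grown-complete seed (here refl) (here refl) r~r = ⊥-elim (~-irrefl r~r)
    grown-complete (attach _ _ _ _ _) (here refl) (here refl) v~v = ⊥-elim (~-irrefl v~v)
    grown-complete (attach _ _ _ _ only) (here refl) (there v∈) u~v
      with refl ← only v∈ u~v = inj₁ (here refl)
    grown-complete (attach _ _ _ _ only) (there u∈) (here refl) u~v
      with refl ← only u∈ (~-sym u~v) = inj₂ (here refl)
    grown-complete (attach g _ _ _ _) (there u∈) (there v∈) u~v =
      [ inj₁ ∘ there , inj₂ ∘ there ]′ (grown-complete g u∈ v∈ u~v)

    vertices-unique : ∀ {ps} → Grown r ps → Unique (vertices r ps)
    vertices-unique seed                 = [] ∷ []
    vertices-unique (attach g _ v∉ _ _) =
      All.tabulate (λ { x∈ refl → v∉ x∈ }) ∷ vertices-unique g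

    length-vertices : ∀ ps → length (vertices r ps) ≡ suc (length ps)
    length-vertices []       = refl
    length-vertices (_ ∷ ps) = cong suc (length-vertices ps)

    module _ (connected : Connected) (acyclic : Acyclic) where

      frontier : ∀ {S a x} → Star _~_ a x → a ∈ S → x ∉ S → ∃[ u ] ∃[ v ] (u ∈ S × v ∉ S × u ~ v)
      frontier ε a∈ a∉ = contradiction a∈ a∉
      frontier {S} (_◅_ {a} {b} a~b b⋯x) a∈ x∉ with Fin._≟_ ∈?[ b ] S
      ... | yes b∈ = frontier b⋯x b∈ x∉
      ... | no  b∉ = a , b , a∈ , b∉ , a~b

      r∈vertices : ∀ ps → r ∈ vertices r ps
      r∈vertices []       = here refl
      r∈vertices (_ ∷ ps) = there (r∈vertices ps)

      grow-or-stop : ∀ k → (∃[ ps ] (Grown r ps × ∀ x → x ∈ vertices r ps))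
                         ⊎ (∃[ ps ] (Grown r ps × length ps ≡ k))
      grow-or-stop zero = inj₂ ([] , seed , refl)
      grow-or-stop (suc k) with grow-or-stop k
      ... | inj₁ full = inj₁ full
      ... | inj₂ (ps , g , refl) with Fin.all? (λ x → Fin._≟_ ∈?[ x ] vertices r ps)
      ...   | yes all = inj₁ (ps , g , all)
      ...   | no ¬all
        with x , x∉ ← Fin.¬∀⟶∃¬ n _ (λ x → Fin._≟_ ∈?[ x ] vertices r ps) ¬all
        with u , v , u∈ , v∉ , u~v ← frontier (connected r x) (r∈vertices ps) x∉
        = inj₂ ((v , u) ∷ ps
          , attach g u∈ v∉ (~-sym u~v) (λ u′∈ → unique-neighbour acyclic g u∈ u′∈ v∉ (~-sym u~v))
          , refl)

      -- Growth can stall only when every vertex is present, by connectedness; n attachments would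
      -- give n + 1 distinct vertices among n.
      spanning-growth : ∃[ ps ] (Grown r ps × ∀ x → x ∈ vertices r ps)
      spanning-growth with grow-or-stop n
      ... | inj₁ full = full
      ... | inj₂ (ps , g , eq) = ⊥-elim (ℕ.1+n≰n (subst (ℕ._≤ n) (trans (length-vertices ps) (cong suc eq))
              (injective⇒≤ (lookup-injective (vertices-unique g)))))

    vertices-↭ : ∀ {ps} → Grown r ps → (∀ x → x ∈ vertices r ps) → vertices r ps ↭ allFin n
    vertices-↭ g all = ∼bag⇒↭ (unique∧set⇒bag (vertices-unique g) (Unique.allFin⁺ n)
      (mk⇔ (λ _ → ∈-allFin _) (λ _ → all _)))

-- Colourings by type

bools : List Bool
bools = inside ∷ outside ∷ []

bools-unique : Unique bools
bools-unique = ((λ ()) ∷ []) ∷ [] ∷ []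

∈-bools : ∀ b → b ∈ bools
∈-bools true  = here refl
∈-bools false = there (here refl)

∑-bools : ∀ f → ⅀ bools f ≡ f true + f false
∑-bools f = trans (∑-∷ true _ f) (cong (f true +_)
  (trans (∑-∷ false _ f) (trans (cong (f false +_) (∑-[] f)) (ℚ.+-identityʳ _))))

-- The head of the list is the innermost sum, so the vertex attached last is summed out first. `κ`
-- supplies the entries at vertices outside the list.
sumOver : List A → List (Fin n) → (Vec A n → ℚ) → Vec A n → ℚ
sumOver as []       f κ = f κ
sumOver as (v ∷ vs) f κ = sumOver as vs (λ κ → ⅀[ a ← as ] f (κ [ v ]≔ a)) κ

sumOver-cong : ∀ (as : List A) (vs : List (Fin n)) {f g} → (∀ κ → f κ ≡ g κ) → ∀ κ →
               sumOver as vs f κ ≡ sumOver as vs g κ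
sumOver-cong as []       f≗g κ = f≗g κ
sumOver-cong as (v ∷ vs) f≗g κ = sumOver-cong as vs (λ κ → ∑-cong as λ a → f≗g (κ [ v ]≔ a)) κ

sumOver-↭ : ∀ (as : List A) {vs ws : List (Fin n)} → vs ↭ ws → ∀ f κ →
            sumOver as vs f κ ≡ sumOver as ws f κ
sumOver-↭ as Perm.refl          f κ = refl
sumOver-↭ as (Perm.prep v π)    f κ = sumOver-↭ as π _ κ
sumOver-↭ as (Perm.swap {xs = vs} u v π) f κ with u Fin.≟ v
... | yes refl = sumOver-↭ as π _ κ
... | no u≢v   = trans
  (sumOver-cong as vs (λ κ → trans (∑-swap as as _) (∑-cong as λ a → ∑-cong as λ b →
    cong f (Vec.[]≔-commutes κ v u (u≢v ∘ sym)))) κ)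
  (sumOver-↭ as π _ κ)
sumOver-↭ as (Perm.trans π₁ π₂) f κ = trans (sumOver-↭ as π₁ f κ) (sumOver-↭ as π₂ f κ)

sumOver-suc : ∀ (as : List A) (vs : List (Fin n)) f a κ →
              sumOver as (map suc vs) f (a ∷ κ) ≡ sumOver as vs (λ κ → f (a ∷ κ)) κ
sumOver-suc as []       f a κ = refl
sumOver-suc as (v ∷ vs) f a κ = sumOver-suc as vs _ a κ

sumOver-allFin : ∀ (as : List A) f (κ : Vec A n) →
                 sumOver as (allFin n) f κ ≡ ⅀ (allVecs as n) f
sumOver-allFin as f [] = sym (trans (∑-∷ [] [] f) (trans (cong (f [] +_) (∑-[] f)) (ℚ.+-identityʳ _)))
sumOver-allFin {n = suc n} as f (a ∷ κ) = begin
  sumOver as (tabulate suc) (λ κ → ⅀[ b ← as ] f (κ [ zero ]≔ b)) (a ∷ κ)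
    ≡⟨ cong (λ vs → sumOver as vs (λ κ → ⅀[ b ← as ] f (κ [ zero ]≔ b)) (a ∷ κ))
         (sym (List.map-tabulate id suc)) ⟩
  sumOver as (map suc (allFin n)) (λ κ → ⅀[ b ← as ] f (κ [ zero ]≔ b)) (a ∷ κ)
    ≡⟨ sumOver-suc as (allFin n) _ a κ ⟩
  sumOver as (allFin n) (λ κ → ⅀[ b ← as ] f (b ∷ κ)) κ
    ≡⟨ sumOver-allFin as _ κ ⟩
  ⅀[ κ ← allVecs as n ] ⅀[ b ← as ] f (b ∷ κ)
    ≡⟨ trans (∑-swap (allVecs as n) as _) (sym (∑-cartesianProductWith _∷_ as (allVecs as n) f)) ⟩
  ⅀ (allVecs as (suc n)) f ∎

treeProduct : (A → ℚ) → (A → A → ℚ) → Fin n → List (Fin n × Fin n) → Vec A n → ℚ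
treeProduct f g r []             κ = f (lookup κ r)
treeProduct f g r ((v , u) ∷ ps) κ = g (lookup κ v) (lookup κ u) * treeProduct f g r ps κ

treeSum : (A → ℕ) → (A → A → ℕ) → Fin n → List (Fin n × Fin n) → Vec A n → ℕ
treeSum f g r []             κ = f (lookup κ r)
treeSum f g r ((v , u) ∷ ps) κ = g (lookup κ v) (lookup κ u) ℕ.+ treeSum f g r ps κ

module _ {n : ℕ} (T : Graph n) {r : Fin n} where

  lookup-other : ∀ {S u v} → u ∈ S → v ∉ S → ∀ (κ : Vec A n) a → lookup (κ [ v ]≔ a) u ≡ lookup κ u
  lookup-other {u = u} u∈ v∉ κ a = Vec.lookup∘updateAt′ _ _ (λ { refl → v∉ u∈ }) κ

  treeProduct-update : ∀ (f : A → ℚ) g {ps} → Grown T r ps → ∀ {v} → v ∉ vertices r ps → ∀ κ a →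
                       treeProduct f g r ps (κ [ v ]≔ a) ≡ treeProduct f g r ps κ
  treeProduct-update f g seed v∉ κ a = cong f (lookup-other (here refl) v∉ κ a)
  treeProduct-update f g (attach γ u∈ _ _ _) v∉ κ a = cong₂ _*_
    (cong₂ g (lookup-other (here refl) v∉ κ a) (lookup-other (there u∈) v∉ κ a))
    (treeProduct-update f g γ (v∉ ∘ there) κ a)

  -- Colours are summed out one vertex at a time, leaves first, remembering
  -- only their types.
  module _ (as : List A) (bs : List B) (τ : A → B)
    (f : A → ℚ) (g : A → A → ℚ) (f′ : B → ℚ) (g′ : B → B → ℚ)
    (sum-f : ∀ (h : B → ℚ) → ⅀[ a ← as ] f a * h (τ a) ≡ ⅀[ b ← bs ] f′ b * h b)
    (sum-g : ∀ a′ (h : B → ℚ) → ⅀[ a ← as ] g a a′ * h (τ a) ≡ ⅀[ b ← bs ] g′ b (τ a′) * h b)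
    where

    -- `h` collects what the vertices already summed out have left behind. By `sum-g` this depends
    -- on the remaining colours only through their types, which is why the induction runs with `h`
    -- arbitrary.
    sumOver-types : ∀ {ps} → Grown T r ps → ∀ h κ →
      sumOver as (vertices r ps) (λ κ → treeProduct f g r ps κ * h (Vec.map τ κ)) κ
      ≡ sumOver bs (vertices r ps) (λ W → treeProduct f′ g′ r ps W * h W) (Vec.map τ κ)
    sumOver-types seed h κ = begin
      ⅀[ a ← as ] f (lookup (κ [ r ]≔ a) r) * h (Vec.map τ (κ [ r ]≔ a))
        ≡⟨ ∑-cong as (λ a → cong₂ (λ a W → f a * h W) (Vec.lookup∘updateAt r κ) (Vec.map-[]≔ τ κ r)) ⟩
      ⅀[ a ← as ] f a * h (Vec.map τ κ [ r ]≔ τ a)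
        ≡⟨ sum-f (λ b → h (Vec.map τ κ [ r ]≔ b)) ⟩
      ⅀[ b ← bs ] f′ b * h (Vec.map τ κ [ r ]≔ b)
        ≡⟨ ∑-cong bs (λ b → cong (λ b′ → f′ b′ * h (Vec.map τ κ [ r ]≔ b)) (sym (Vec.lookup∘updateAt r (Vec.map τ κ)))) ⟩
      ⅀[ b ← bs ] f′ (lookup (Vec.map τ κ [ r ]≔ b) r) * h (Vec.map τ κ [ r ]≔ b) ∎
    sumOver-types (attach {ps} {v} {u} γ u∈ v∉ _ _) h κ = begin
      sumOver as (vertices r ps) (λ κ → ⅀[ a ← as ]
        treeProduct f g r ((v , u) ∷ ps) (κ [ v ]≔ a) * h (Vec.map τ (κ [ v ]≔ a))) κ
        ≡⟨ sumOver-cong as (vertices r ps) outer κ ⟩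
      sumOver as (vertices r ps) (λ κ → treeProduct f g r ps κ * h′ (Vec.map τ κ)) κ
        ≡⟨ sumOver-types γ h′ κ ⟩
      sumOver bs (vertices r ps) (λ W → treeProduct f′ g′ r ps W * h′ W) (Vec.map τ κ)
        -- The computation of `inner` for types instead of colours, read backwards.
        ≡⟨ sumOver-cong bs (vertices r ps) (λ W → sym (inner bs f′ g′ h W λ _ → refl)) (Vec.map τ κ) ⟩
      sumOver bs (vertices r ps) (λ W → ⅀[ b ← bs ]
        treeProduct f′ g′ r ((v , u) ∷ ps) (W [ v ]≔ b) * h (W [ v ]≔ b)) (Vec.map τ κ) ∎
      where
      open +-*-Solver
      h′ : Vec B n → ℚ
      h′ W = ⅀[ b ← bs ] g′ b (lookup W u) * h (W [ v ]≔ b)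
      inner : ∀ {E : Set} (es : List E) (f : E → ℚ) g (h : Vec E n → ℚ) κ {h″ : E → ℚ} →
        (∀ a → h (κ [ v ]≔ a) ≡ h″ a) →
        ⅀[ a ← es ] treeProduct f g r ((v , u) ∷ ps) (κ [ v ]≔ a) * h (κ [ v ]≔ a)
        ≡ treeProduct f g r ps κ * ⅀ es (λ a → g a (lookup κ u) * h″ a)
      inner es f g h κ {h″} h≗ = trans
        (∑-cong es λ a → trans
          (cong₂ _*_ (cong₂ _*_ (cong₂ g (Vec.lookup∘updateAt v κ) (lookup-other u∈ v∉ κ a))
                                (treeProduct-update f g γ v∉ κ a)) (h≗ a))
          (solve 3 (λ p q s → (p :* q) :* s := q :* (p :* s)) refl
             (g a (lookup κ u)) (treeProduct f g r ps κ) (h″ a)))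
        (sym (*-∑ (treeProduct f g r ps κ) es _))
      outer : ∀ κ → ⅀[ a ← as ] treeProduct f g r ((v , u) ∷ ps) (κ [ v ]≔ a) * h (Vec.map τ (κ [ v ]≔ a))
                    ≡ treeProduct f g r ps κ * h′ (Vec.map τ κ)
      outer κ = trans
        (inner as f g (h ∘ Vec.map τ) κ λ a → cong h (Vec.map-[]≔ τ κ v))
        (cong (treeProduct f g r ps κ *_) (trans
          (sum-g (lookup κ u) (λ b → h (Vec.map τ κ [ v ]≔ b)))
          (∑-cong bs λ b → cong (λ b′ → g′ b b′ * h (Vec.map τ κ [ v ]≔ b)) (sym (Vec.lookup-map u τ κ)))))

    -- The given colour only fills the initial vector, whose entries are all overwritten because the
    -- vertices of the growth exhaust `Fin n`.
    ∑-types : ∀ {ps} → Grown T r ps → vertices r ps ↭ allFin n → A →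
      ⅀ (allVecs as n) (treeProduct f g r ps) ≡ ⅀ (allVecs bs n) (treeProduct f′ g′ r ps)
    ∑-types {ps} γ π a₀ = begin
      ⅀ (allVecs as n) (treeProduct f g r ps)
        ≡⟨ sym (expand as _ κ₀) ⟩
      sumOver as (vertices r ps) (λ κ → treeProduct f g r ps κ * 1ℚ) κ₀
        ≡⟨ sumOver-types γ (λ _ → 1ℚ) κ₀ ⟩
      sumOver bs (vertices r ps) (λ W → treeProduct f′ g′ r ps W * 1ℚ) (Vec.map τ κ₀)
        ≡⟨ expand bs _ _ ⟩
      ⅀ (allVecs bs n) (treeProduct f′ g′ r ps) ∎
      where
      κ₀ : Vec A n
      κ₀ = replicate n a₀
      expand : ∀ {E : Set} (es : List E) (f : Vec E n → ℚ) κ →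
               sumOver es (vertices r ps) (λ κ → f κ * 1ℚ) κ ≡ ⅀ (allVecs es n) f
      expand es f κ = trans (sumOver-↭ es π _ κ)
        (trans (sumOver-allFin es _ κ) (∑-cong (allVecs es n) λ κ → ℚ.*-identityʳ (f κ)))

-- Component counts along the rooted tree

bit : Bool → ℕ
bit b = if b then 1 else 0

-- The tops on side β of W are the vertices without a parent on the same side;
-- there is one for each component of the subgraph induced on that side.
size tops kept : Bool → Fin n → List (Fin n × Fin n) → Subset n → ℕ
size β = treeSum (λ b → bit (does (b Bool.≟ β))) (λ b _ → bit (does (b Bool.≟ β)))
tops β = treeSum (λ b → bit (does (b Bool.≟ β))) (λ b b′ → bit (does (b Bool.≟ β) ∧ not (does (b′ Bool.≟ β))))
kept β = treeSum (λ _ → 0) (λ b b′ → bit (does (b Bool.≟ β) ∧ does (b′ Bool.≟ β)))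

cut : Fin n → List (Fin n × Fin n) → Subset n → ℕ
cut = treeSum (λ _ → 0) (λ b b′ → bit (not (does (b Bool.≟ b′))))

module _ (r : Fin n) where

  tops+kept : ∀ β ps W → tops β r ps W ℕ.+ kept β r ps W ≡ size β r ps W
  tops+kept β [] W = ℕ.+-identityʳ _
  tops+kept β ((v , u) ∷ ps) W with does (lookup W v Bool.≟ β) | does (lookup W u Bool.≟ β)
  ... | true  | true  = trans (ℕ.+-suc _ _) (cong suc (tops+kept β ps W))
  ... | true  | false = cong suc (tops+kept β ps W)
  ... | false | true  = tops+kept β ps W
  ... | false | false = tops+kept β ps W

  size+size : ∀ ps W → size true r ps W ℕ.+ size false r ps W ≡ suc (length ps)
  size+size [] W with lookup W r
  ... | true  = refl
  ... | false = refl
  size+size ((v , u) ∷ ps) W with lookup W v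
  ... | true  = cong suc (size+size ps W)
  ... | false = trans (ℕ.+-suc _ _) (cong suc (size+size ps W))

  -- The component of the root has the root as its top; any other top is the child end of a cut
  -- edge, and conversely. With one top inside W, the tops outside number exactly the cut edges.
  tops+tops : ∀ ps W → tops true r ps W ℕ.+ tops false r ps W ≡ suc (cut r ps W)
  tops+tops [] W with lookup W r
  ... | true  = refl
  ... | false = refl
  tops+tops ((v , u) ∷ ps) W with lookup W v | lookup W u
  ... | true  | true  = tops+tops ps W
  ... | true  | false = cong suc (tops+tops ps W)
  ... | false | true  = trans (ℕ.+-suc _ _) (cong suc (tops+tops ps W))
  ... | false | false = tops+tops ps W

  size-true : ∀ ps W → size true r ps W ≡ sum (map (bit ∘ lookup W) (vertices r ps))
  size-true [] W with lookup W r
  ... | true  = refl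
  ... | false = refl
  size-true ((v , u) ∷ ps) W with lookup W v
  ... | true  = cong suc (size-true ps W)
  ... | false = size-true ps W

∣∣-sum : ∀ (W : Subset n) → ∣ W ∣ ≡ sum (map (bit ∘ lookup W) (allFin n))
∣∣-sum []      = refl
∣∣-sum {suc n} (b ∷ W) = trans (head b) (cong (bit b ℕ.+_) (trans (∣∣-sum W) (cong sum (begin
  map (bit ∘ lookup W) (allFin n)             ≡⟨ List.map-tabulate id (bit ∘ lookup W) ⟩
  tabulate (bit ∘ lookup W)                   ≡⟨ sym (List.map-tabulate suc (bit ∘ lookup (b ∷ W))) ⟩
  map (bit ∘ lookup (b ∷ W)) (tabulate suc)   ∎))))
  where
  head : ∀ b → ∣ b ∷ W ∣ ≡ bit b ℕ.+ ∣ W ∣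
  head true  = refl
  head false = refl

∑-allFin-suc : ∀ k (f : Fin (suc k) → ℚ) → ⅀ (allFin (suc k)) f ≡ f zero + ⅀ (allFin k) (f ∘ suc)
∑-allFin-suc k f = trans (∑-∷ zero _ f) (cong (f zero +_) (trans
  (cong (λ is → ⅀ is f) (sym (List.map-tabulate id suc))) (∑-map suc (allFin k) f)))

-- Proper colourings with two types of colours

palette : ∀ M {z} → Fin (M ℕ.+ z) → Bool
palette zero    _       = false
palette (suc M) zero    = true
palette (suc M) (suc i) = palette M i

∑-palette : ∀ M z (h : Bool → ℚ) →
            ⅀ (allFin (M ℕ.+ z)) (h ∘ palette M) ≡ ι M * h true + ι z * h false
∑-palette zero zero h = trans (∑-[] _)
  (solve 2 (λ a b → con 0ℚ := con 0ℚ :* a :+ con 0ℚ :* b) refl (h true) (h false))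
  where open +-*-Solver
∑-palette zero (suc z) h = trans (∑-allFin-suc z _) (trans (cong (h false +_) (∑-palette zero z h))
  (solve 3 (λ a b z → b :+ (con 0ℚ :* a :+ z :* b) := con 0ℚ :* a :+ (con 1ℚ :+ z) :* b) refl
     (h true) (h false) (ι z)))
  where open +-*-Solver
∑-palette (suc M) z h = trans (∑-allFin-suc (M ℕ.+ z) _) (trans (cong (h true +_) (∑-palette M z h))
  (solve 4 (λ a b m z → a :+ (m :* a :+ z :* b) := (con 1ℚ :+ m) :* a :+ z :* b) refl
     (h true) (h false) (ι M) (ι z)))
  where open +-*-Solver

module _ {n : ℕ} (T : Graph n) {r : Fin n} {ps : List (Fin n × Fin n)}
         (γ : Grown T r ps) (spans : ∀ x → x ∈ vertices r ps) where
  open Graph T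

  private
    π : vertices r ps ↭ allFin n
    π = vertices-↭ T γ spans

  size≡∣∣ : ∀ W → size true r ps W ≡ ∣ W ∣
  size≡∣∣ W = trans (size-true r ps W)
    (trans (sum-↭ (map⁺ (bit ∘ lookup W) π)) (sym (∣∣-sum W)))

  suc-length-ps : suc (length ps) ≡ n
  suc-length-ps = trans (sym (length-vertices T ps)) (trans (↭-length π) (List.length-tabulate {n = n} id))

  module _ {N : ℕ} (w : Fin N → ℚ) where

    -- The parent's colour stands on the left of `≟`, since `∑-select` compares a fixed element with
    -- the running one.
    differ : Fin N → Fin N → ℚ
    differ a b = ind (not (does (b Fin.≟ a))) * w a

    differ? : ∀ (κ : Vec (Fin N) n) ps → Dec (All (λ (e : Fin n × Fin n) → lookup κ (proj₂ e) ≢ lookup κ (proj₁ e)) ps)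
    differ? κ = All.all? (λ e → ¬? (lookup κ (proj₂ e) Fin.≟ lookup κ (proj₁ e)))

    treeProduct-differ : ∀ ps (κ : Vec (Fin N) n) → ind (does (differ? κ ps)) * ∏ℚ (vertices r ps) (w ∘ lookup κ)
                                  ≡ treeProduct w differ r ps κ
    treeProduct-differ [] κ = trans (ℚ.*-identityˡ _) (ℚ.*-identityʳ _)
    treeProduct-differ ((v , u) ∷ ps) κ = begin
      ind (does (differ? κ ((v , u) ∷ ps))) * (w (lookup κ v) * ∏ℚ (vertices r ps) (w ∘ lookup κ))
        ≡⟨ cong (_* (w (lookup κ v) * ∏ℚ (vertices r ps) (w ∘ lookup κ)))
             (ind-∧ (not (does (lookup κ u Fin.≟ lookup κ v))) (does (differ? κ ps))) ⟩
      ind (not (does (lookup κ u Fin.≟ lookup κ v))) * ind (does (differ? κ ps))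
        * (w (lookup κ v) * ∏ℚ (vertices r ps) (w ∘ lookup κ))
        ≡⟨ solve 4 (λ a b c d → a :* b :* (c :* d) := a :* c :* (b :* d)) refl
             (ind (not (does (lookup κ u Fin.≟ lookup κ v)))) (ind (does (differ? κ ps)))
             (w (lookup κ v)) (∏ℚ (vertices r ps) (w ∘ lookup κ)) ⟩
      differ (lookup κ v) (lookup κ u) * (ind (does (differ? κ ps)) * ∏ℚ (vertices r ps) (w ∘ lookup κ))
        ≡⟨ cong (differ (lookup κ v) (lookup κ u) *_) (treeProduct-differ ps κ) ⟩
      treeProduct w differ r ((v , u) ∷ ps) κ ∎
      where open +-*-Solver

    -- The pairs list all edges of the tree, so properness factors into one condition per
    -- child-parent pair.
    proper-treeProduct : ∀ (κ : Vec (Fin N) n) → ind (does (isProper? T κ)) * ∏ℚ (allFin n) (w ∘ lookup κ)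
                               ≡ treeProduct w differ r ps κ
    proper-treeProduct κ = trans
      (cong₂ (λ b q → ind b * q) (does-⇔ (mk⇔ to from) (isProper? T κ) (differ? κ ps))
                                 (sym (∏-↭ (w ∘ lookup κ) π)))
      (treeProduct-differ ps κ)
      where
      to : IsProper T κ → All (λ (e : Fin n × Fin n) → lookup κ (proj₂ e) ≢ lookup κ (proj₁ e)) ps
      to proper = All.tabulate λ {e} e∈ → proper _ _ (~-sym (grown-sound T γ e∈))
      from : All (λ (e : Fin n × Fin n) → lookup κ (proj₂ e) ≢ lookup κ (proj₁ e)) ps → IsProper T κ
      from differs u v u~v with grown-complete T γ (spans u) (spans v) u~v
      ... | inj₁ e∈ = All.lookup differs e∈ ∘ sym
      ... | inj₂ e∈ = All.lookup differs e∈

  module _ (M z : ℕ) (t : ℚ) where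

    typeWeight number : Bool → ℚ
    typeWeight b = if b then t else 1ℚ
    number     b = if b then ι (suc M) else ι z

    summand : Subset n → ℚ
    summand W = t ^ size true r ps W
              * (ι (suc M) ^ tops true r ps W * (ι (suc M) - 1ℚ) ^ kept true r ps W)
              * (ι z ^ tops false r ps W * (ι z - 1ℚ) ^ kept false r ps W)

    private
      #colours : ℕ
      #colours = suc M ℕ.+ z

      τ : Fin #colours → Bool
      τ = palette (suc M)

      w : Fin #colours → ℚ
      w = typeWeight ∘ τ

      f′ : Bool → ℚ
      f′ b = number b * typeWeight b

      -- The parent forbids a single colour, which diminishes the count of a type only when parent
      -- and child share that type.
      g′ : Bool → Bool → ℚ
      g′ b b′ = (number b - ind (does (b Bool.≟ b′))) * typeWeight b

      open +-*-Solver

      treeProduct-types : ∀ ps W → treeProduct f′ g′ r ps W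
        ≡ t ^ size true r ps W
        * (ι (suc M) ^ tops true r ps W * (ι (suc M) - 1ℚ) ^ kept true r ps W)
        * (ι z ^ tops false r ps W * (ι z - 1ℚ) ^ kept false r ps W)
      treeProduct-types [] W with lookup W r
      ... | true  = solve 2 (λ m t → m :* t := t :* con 1ℚ :* (m :* con 1ℚ :* con 1ℚ) :* (con 1ℚ :* con 1ℚ))
                      refl (ι (suc M)) t
      ... | false = solve 1 (λ z → z :* con 1ℚ := con 1ℚ :* (con 1ℚ :* con 1ℚ) :* (z :* con 1ℚ :* con 1ℚ))
                      refl (ι z)
      treeProduct-types ((v , u) ∷ ps) W =
        trans (cong (g′ (lookup W v) (lookup W u) *_) (treeProduct-types ps W))
              (step (lookup W v) (lookup W u))
        where
        st = size true r ps W
        tt = tops true r ps W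
        kt = kept true r ps W
        tf = tops false r ps W
        kf = kept false r ps W
        S = t ^ st
        P = ι (suc M) ^ tt
        Q = (ι (suc M) - 1ℚ) ^ kt
        Y = ι z ^ tf
        Z = (ι z - 1ℚ) ^ kf
        step : ∀ b b′ → g′ b b′ * (S * (P * Q) * (Y * Z))
          ≡ t ^ (bit (does (b Bool.≟ true)) ℕ.+ st)
          * (ι (suc M) ^ (bit (does (b Bool.≟ true) ∧ not (does (b′ Bool.≟ true))) ℕ.+ tt)
             * (ι (suc M) - 1ℚ) ^ (bit (does (b Bool.≟ true) ∧ does (b′ Bool.≟ true)) ℕ.+ kt))
          * (ι z ^ (bit (does (b Bool.≟ false) ∧ not (does (b′ Bool.≟ false))) ℕ.+ tf)
             * (ι z - 1ℚ) ^ (bit (does (b Bool.≟ false) ∧ does (b′ Bool.≟ false)) ℕ.+ kf))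
        step true  true  = solve 7 (λ m t s p q x y → (m :- con 1ℚ) :* t :* (s :* (p :* q) :* (x :* y))
                             := t :* s :* (p :* ((m :- con 1ℚ) :* q)) :* (x :* y))
                             refl (ι (suc M)) t S P Q Y Z
        step true  false = solve 7 (λ m t s p q x y → (m :- con 0ℚ) :* t :* (s :* (p :* q) :* (x :* y))
                             := t :* s :* (m :* p :* q) :* (x :* y))
                             refl (ι (suc M)) t S P Q Y Z
        step false true  = solve 6 (λ z s p q x y → (z :- con 0ℚ) :* con 1ℚ :* (s :* (p :* q) :* (x :* y))
                             := s :* (p :* q) :* (z :* x :* y))
                             refl (ι z) S P Q Y Z
        step false false = solve 6 (λ z s p q x y → (z :- con 1ℚ) :* con 1ℚ :* (s :* (p :* q) :* (x :* y))
                             := s :* (p :* q) :* (x :* ((z :- con 1ℚ) :* y)))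
                             refl (ι z) S P Q Y Z

      sum-f : ∀ (h : Bool → ℚ) → ⅀[ a ← allFin #colours ] w a * h (τ a) ≡ ⅀[ b ← bools ] f′ b * h b
      sum-f h = trans (∑-palette (suc M) z (λ b → typeWeight b * h b)) (sym (trans (∑-bools _)
        (cong₂ _+_ (ℚ.*-assoc (ι (suc M)) t (h true)) (ℚ.*-assoc (ι z) 1ℚ (h false)))))

      sum-g : ∀ a′ (h : Bool → ℚ) → ⅀[ a ← allFin #colours ] differ w a a′ * h (τ a) ≡ ⅀[ b ← bools ] g′ b (τ a′) * h b
      sum-g a′ h = begin
        ⅀[ a ← allFin #colours ] differ w a a′ * h (τ a)
          -- The sum over the colours other than `a′` is the full sum minus one term.
          ≡⟨ ∑-cong (allFin #colours) (λ a → complement (does (a′ Fin.≟ a)) (w a) (h (τ a))) ⟩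
        ⅀[ a ← allFin #colours ] w a * h (τ a) + - 1ℚ * (ind (does (a′ Fin.≟ a)) * (w a * h (τ a)))
          ≡⟨ trans (∑-+ (allFin #colours) _ _) (cong₂ _+_ (sum-f h) (trans (sym (*-∑ (- 1ℚ) (allFin #colours) _))
               (cong (- 1ℚ *_) (∑-select Fin._≟_ (Unique.allFin⁺ #colours) (∈-allFin a′) (λ a → w a * h (τ a)))))) ⟩
        (⅀[ b ← bools ] f′ b * h b) + - 1ℚ * (w a′ * h (τ a′))
          ≡⟨ cong (_+ - 1ℚ * (w a′ * h (τ a′))) (∑-bools _) ⟩
        f′ true * h true + f′ false * h false + - 1ℚ * (w a′ * h (τ a′))
          ≡⟨ types (τ a′) ⟩
        g′ true (τ a′) * h true + g′ false (τ a′) * h false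
          ≡⟨ sym (∑-bools _) ⟩
        ⅀[ b ← bools ] g′ b (τ a′) * h b ∎
        where
        complement : ∀ b p q → ind (not b) * p * q ≡ p * q + - 1ℚ * (ind b * (p * q))
        complement true  = solve 2 (λ p q → con 0ℚ :* p :* q := p :* q :+ :- con 1ℚ :* (con 1ℚ :* (p :* q))) refl
        complement false = solve 2 (λ p q → con 1ℚ :* p :* q := p :* q :+ :- con 1ℚ :* (con 0ℚ :* (p :* q))) refl
        types : ∀ b′ → f′ true * h true + f′ false * h false + - 1ℚ * (typeWeight b′ * h b′)
                       ≡ g′ true b′ * h true + g′ false b′ * h false
        types true  = solve 5 (λ m z t p q →
          m :* t :* p :+ z :* con 1ℚ :* q :+ :- con 1ℚ :* (t :* p)
          := (m :- con 1ℚ) :* t :* p :+ (z :- con 0ℚ) :* con 1ℚ :* q) refl (ι (suc M)) (ι z) t (h true) (h false)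
        types false = solve 5 (λ m z t p q →
          m :* t :* p :+ z :* con 1ℚ :* q :+ :- con 1ℚ :* (con 1ℚ :* q)
          := (m :- con 0ℚ) :* t :* p :+ (z :- con 1ℚ) :* con 1ℚ :* q) refl (ι (suc M)) (ι z) t (h true) (h false)

    two-type-colourings : ∀ c → IsPowerSumExpansion T c →
      ⅀ (subsets n) summand
      ≡ ⅀[ λs ← partitions n ] c λs * ∏ℚ λs (λ k → ι (suc M) * t ^ k + ι z)
    two-type-colourings c X≈ = begin
      ⅀ (subsets n) summand
        ≡⟨ sym (∑-cong (subsets n) (treeProduct-types ps)) ⟩
      ⅀ (subsets n) (treeProduct f′ g′ r ps)
        ≡⟨ sym (∑-types T (allFin #colours) bools τ w (differ w) f′ g′ sum-f sum-g γ π zero) ⟩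
      ⅀ (allVecs (allFin #colours) n) (treeProduct w (differ w) r ps)
        ≡⟨ sym (∑-cong (allVecs (allFin #colours) n) (proper-treeProduct w)) ⟩
      ⅀[ κ ← allVecs (allFin #colours) n ] ind (does (isProper? T κ)) * ∏ℚ (allFin n) (w ∘ lookup κ)
        ≡⟨ substitute-expansion T c X≈ w ⟩
      ⅀[ λs ← partitions n ] c λs * ∏ℚ λs (λ k → ⅀ (allFin #colours) (λ i → w i ^ k))
        ≡⟨ ∑-cong (partitions n) (λ λs → cong (c λs *_) (∏-cong λs λ k →
             trans (∑-palette (suc M) z (λ b → typeWeight b ^ k))
                   (cong (λ q → ι (suc M) * t ^ k + q) (trans (cong (ι z *_) (1^ k)) (ℚ.*-identityʳ (ι z)))))) ⟩
      ⅀[ λs ← partitions n ] c λs * ∏ℚ λs (λ k → ι (suc M) * t ^ k + ι z) ∎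
      where
      1^ : ∀ k → 1ℚ ^ k ≡ 1ℚ
      1^ zero    = refl
      1^ (suc k) = trans (ℚ.*-identityˡ _) (1^ k)

-- Extraction of the coefficients in M, t and z

length≤sum : ∀ {ks} → All (0 ℕ.<_) ks → length ks ℕ.≤ sum ks
length≤sum []           = z≤n
length≤sum (0<k ∷ 0<ks) = ℕ.+-mono-≤ 0<k (length≤sum 0<ks)

-- Each of the other parts is at least 1. For a part i of a partition of n this gives l-1 ≤ n-i, the
-- degree up to which `homogeneousPart` has prescribed moments.
part+length≤sum : ∀ {ks k} → All (0 ℕ.<_) ks → k ∈ ks → k ℕ.+ (length ks ∸ 1) ℕ.≤ sum ks
part+length≤sum {k ∷ ks} (_ ∷ 0<ks) (here refl) = ℕ.+-monoʳ-≤ k (length≤sum 0<ks)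
part+length≤sum {k′ ∷ ks@(_ ∷ _)} {k} (0<k′ ∷ 0<ks) (there k∈) =
  subst (ℕ._≤ k′ ℕ.+ sum ks) (sym (ℕ.+-suc k _)) (ℕ.+-mono-≤ 0<k′ (part+length≤sum 0<ks k∈))

module _ {n : ℕ} (T : Graph n) {r : Fin n} where

  no-tops : ∀ {ps} → Grown T r ps → ∀ W → tops true r ps W ≡ 0 → ∀ {x} → x ∈ vertices r ps → lookup W x ≡ false
  no-tops seed W none (here refl) with lookup W r
  ... | false = refl
  no-tops (attach {ps} {v} {u} γ u∈ _ _ _) W none x∈ with lookup W v in eq | lookup W u in eq′
  no-tops (attach γ u∈ _ _ _) W none x∈ | true | true = contradiction (trans (sym eq′) (no-tops γ W none u∈)) λ ()
  no-tops (attach γ u∈ _ _ _) W none (here refl) | false | _ = eq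
  no-tops (attach γ u∈ _ _ _) W none (there x∈)  | false | _ = no-tops γ W none x∈

  -- `linearPart-falling` covers only products with a factor M. A bare (M-1)^b with b > 0 would have
  -- a nonzero linear coefficient, but without tops W is empty and keeps no pair.
  no-tops⇒kept≡0 : ∀ {ps} → Grown T r ps → ∀ W → tops true r ps W ≡ 0 → kept true r ps W ≡ 0
  no-tops⇒kept≡0 seed W none = refl
  no-tops⇒kept≡0 (attach {ps} {v} {u} γ u∈ _ _ _) W none with lookup W v | lookup W u in eq
  ... | true  | true  = contradiction (trans (sym eq) (no-tops γ W none u∈)) λ ()
  ... | false | _     = no-tops⇒kept≡0 γ W none

  module _ {ps : List (Fin n × Fin n)} (γ : Grown T r ps) (spans : ∀ x → x ∈ vertices r ps)
           (c : List ℕ → ℚ) (X≈ : IsPowerSumExpansion T c) where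

    private
      s tt kt tf kf : Subset n → ℕ
      s  = size true r ps
      tt = tops true r ps
      kt = kept true r ps
      tf = tops false r ps
      kf = kept false r ps

      s+tf+kf : ∀ W → s W ℕ.+ (tf W ℕ.+ kf W) ≡ n
      s+tf+kf W = trans (cong (s W ℕ.+_) (tops+kept r false ps W))
        (trans (size+size r ps W) (suc-length-ps T γ spans))

      s≤n : ∀ W → s W ℕ.≤ n
      s≤n W = subst (s W ℕ.≤_) (s+tf+kf W) (ℕ.m≤m+n (s W) _)

      sign : Subset n → ℚ
      sign W = ind (does (tt W ℕ.≟ 1)) * (- 1ℚ) ^ kt W

      linearPart-sign : ∀ W → apply (linearPart n) (λ m → ι m ^ tt W * (ι m - 1ℚ) ^ kt W) ≡ sign W
      linearPart-sign W = go (tt W) (kt W) (no-tops⇒kept≡0 γ W)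
        (subst (ℕ._≤ n) (sym (tops+kept r true ps W)) (s≤n W))
        where
        go : ∀ a b → (a ≡ 0 → b ≡ 0) → a ℕ.+ b ℕ.≤ n →
             apply (linearPart n) (λ m → ι m ^ a * (ι m - 1ℚ) ^ b) ≡ ind (does (a ℕ.≟ 1)) * (- 1ℚ) ^ b
        go zero b b≡0 _ with refl ← b≡0 refl = linearPart-^ n 0 z≤n
        go (suc a) b _ a+b≤n = linearPart-falling n a b a+b≤n

      rest : ℕ → Subset n → ℚ
      rest z W = ι z ^ tf W * (ι z - 1ℚ) ^ kf W

      -- The coefficient of M on both sides of the two-type identity, for fixed `z` and `t`. Sets W
      -- with several components carry a higher power of M and vanish through `sign`.
      after-linearPart : ∀ z t →
        ⅀[ W ← subsets n ] t ^ s W * (sign W * rest z W)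
        ≡ ⅀[ λs ← partitions n ] c λs * ⅀ λs (λ k → t ^ k * ι z ^ (length λs ∸ 1))
      after-linearPart z t = begin
        ⅀[ W ← subsets n ] t ^ s W * (sign W * rest z W)
          ≡⟨ ∑-cong (subsets n) (λ W → trans (reorder (t ^ s W) (sign W) (rest z W))
               (cong (t ^ s W * rest z W *_) (sym (linearPart-sign W)))) ⟩
        ⅀[ W ← subsets n ] t ^ s W * rest z W * L (λ m → ι m ^ tt W * (ι m - 1ℚ) ^ kt W)
          ≡⟨ trans (∑-cong (subsets n) (λ W → sym (apply-* (linearPart n) (t ^ s W * rest z W) _)))
                   (sym (apply-∑ (linearPart n) (subsets n) _)) ⟩
        L (λ m → ⅀[ W ← subsets n ] t ^ s W * rest z W * (ι m ^ tt W * (ι m - 1ℚ) ^ kt W))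
          ≡⟨ apply-cong (linearPart n) (λ M → trans
               (∑-cong (subsets n) λ W → solve 3 (λ a b c → a :* b :* c := a :* c :* b) refl
                  (t ^ s W) (rest z W) (ι (suc M) ^ tt W * (ι (suc M) - 1ℚ) ^ kt W))
               (two-type-colourings T γ spans M z t c X≈)) ⟩
        L (λ m → ⅀[ λs ← partitions n ] c λs * ∏ℚ λs (λ k → ι m * t ^ k + ι z))
          ≡⟨ trans (apply-∑ (linearPart n) (partitions n) _)
                   (∑-cong (partitions n) λ λs → apply-* (linearPart n) (c λs) _) ⟩
        ⅀[ λs ← partitions n ] c λs * L (λ m → ∏ℚ λs (λ k → ι m * t ^ k + ι z))
          ≡⟨ ∑-cong-∈ (partitions n) (λ {λs} λs∈ → cong (c λs *_) (linearPart-∏ n (ι z) t λs (length≤n λs∈))) ⟩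
        ⅀[ λs ← partitions n ] c λs * ⅀ λs (λ k → t ^ k * ι z ^ (length λs ∸ 1)) ∎
        where
        open +-*-Solver
        L = apply (linearPart n)
        reorder : ∀ p q u → p * (q * u) ≡ p * u * q
        reorder = solve 3 (λ p q u → p :* (q :* u) := p :* u :* q) refl
        length≤n : ∀ {λs} → λs ∈ partitions n → length λs ℕ.≤ n
        length≤n {λs} λs∈ with 0<λs , _ , eq ← partitions-sound n λs∈ = subst (length λs ℕ.≤_) eq (length≤sum 0<λs)

    module _ (i j : ℕ) where

      private
        selectPart-moments : ∃[ J ] (∀ k → k ℕ.≤ n → apply J (λ m → ι m ^ k) ≡ ind (does (k ℕ.≟ i)))
        selectPart-moments = apply-moments n (λ k → ind (does (k ℕ.≟ i)))

        selectPart : Functional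
        selectPart = proj₁ selectPart-moments

        D : ℕ
        D = n ∸ i

        after-selectPart : ∀ z →
          ⅀[ W ← subsets n ] ind (does (s W ℕ.≟ i)) * (sign W * rest z W)
          ≡ ⅀[ λs ← partitions n ] c λs * ⅀ λs (λ k → ind (does (k ℕ.≟ i)) * ι z ^ (length λs ∸ 1))
        after-selectPart z = begin
          ⅀[ W ← subsets n ] ind (does (s W ℕ.≟ i)) * (sign W * rest z W)
            ≡⟨ ∑-cong (subsets n) (λ W → trans
                 (cong (_* (sign W * rest z W)) (sym (proj₂ selectPart-moments (s W) (s≤n W))))
                 (trans (ℚ.*-comm _ (sign W * rest z W))
                        (sym (apply-* selectPart (sign W * rest z W) (λ m → ι m ^ s W))))) ⟩
          ⅀[ W ← subsets n ] L (λ m → sign W * rest z W * ι m ^ s W)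
            ≡⟨ sym (apply-∑ selectPart (subsets n) _) ⟩
          L (λ m → ⅀[ W ← subsets n ] sign W * rest z W * ι m ^ s W)
            ≡⟨ apply-cong selectPart (λ e → trans
                 (∑-cong (subsets n) λ W → ℚ.*-comm (sign W * rest z W) (ι (suc e) ^ s W))
                 (after-linearPart z (ι (suc e)))) ⟩
          L (λ m → ⅀[ λs ← partitions n ] c λs * ⅀ λs (λ k → ι m ^ k * ι z ^ (length λs ∸ 1)))
            ≡⟨ trans (apply-∑ selectPart (partitions n) _) (∑-cong-∈ (partitions n) λ {λs} λs∈ → trans
                 (apply-* selectPart (c λs) _)
                 (cong (c λs *_) (trans (apply-∑ selectPart λs _) (∑-cong-∈ λs λ {k} k∈ → trans
                   (trans (apply-cong selectPart λ e → ℚ.*-comm (ι (suc e) ^ k) (ι z ^ (length λs ∸ 1)))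
                          (apply-* selectPart (ι z ^ (length λs ∸ 1)) (λ m → ι m ^ k)))
                   (trans (cong (ι z ^ (length λs ∸ 1) *_) (proj₂ selectPart-moments k (part≤n λs∈ k∈)))
                          (ℚ.*-comm (ι z ^ (length λs ∸ 1)) (ind (does (k ℕ.≟ i))))))))) ⟩
          ⅀[ λs ← partitions n ] c λs * ⅀ λs (λ k → ind (does (k ℕ.≟ i)) * ι z ^ (length λs ∸ 1)) ∎
          where
          L = apply selectPart
          part≤n : ∀ {λs k} → λs ∈ partitions n → k ∈ λs → k ℕ.≤ n
          part≤n {λs} {k} λs∈ k∈ with 0<λs , _ , eq ← partitions-sound n λs∈ =
            ℕ.≤-trans (ℕ.m≤m+n k (length λs ∸ 1)) (subst (k ℕ.+ (length λs ∸ 1) ℕ.≤_) eq (part+length≤sum 0<λs k∈))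

      -- Here the coordinate in z is taken. The signs of the connected sets remain until their size
      -- is used in `subtree-count`.
      signed-count :
        ⅀[ W ← subsets n ] ind (does (s W ℕ.≟ i)) * (sign W * ind (does (tf W ℕ.≟ j)))
        ≡ ⅀[ λs ← partitions n ] c λs * ⅀ λs (λ k → ind (does (k ℕ.≟ i)) * homogeneousPart-moment D j (length λs ∸ 1))
      signed-count = begin
        ⅀[ W ← subsets n ] ind (does (s W ℕ.≟ i)) * (sign W * ind (does (tf W ℕ.≟ j)))
          ≡⟨ ∑-cong (subsets n) (λ W → trans (select W (s W ℕ.≟ i))
               (trans (sym (ℚ.*-assoc (ind (does (s W ℕ.≟ i))) (sign W) (L (λ m → rest m W))))
                      (sym (apply-* H (ind (does (s W ℕ.≟ i)) * sign W) (λ m → rest m W))))) ⟩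
        ⅀[ W ← subsets n ] L (λ m → ind (does (s W ℕ.≟ i)) * sign W * rest m W)
          ≡⟨ sym (apply-∑ H (subsets n) _) ⟩
        L (λ m → ⅀[ W ← subsets n ] ind (does (s W ℕ.≟ i)) * sign W * rest m W)
          ≡⟨ apply-cong H (λ e → trans
               (∑-cong (subsets n) λ W → ℚ.*-assoc (ind (does (s W ℕ.≟ i))) (sign W) (rest (suc e) W))
               (after-selectPart (suc e))) ⟩
        L (λ m → ⅀[ λs ← partitions n ] c λs * ⅀ λs (λ k → ind (does (k ℕ.≟ i)) * ι m ^ (length λs ∸ 1)))
          ≡⟨ trans (apply-∑ H (partitions n) _) (∑-cong-∈ (partitions n) λ {λs} λs∈ → trans
               (apply-* H (c λs) _)
               (cong (c λs *_) (trans (apply-∑ H λs _) (∑-cong-∈ λs λ {k} k∈ → trans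
                 (apply-* H (ind (does (k ℕ.≟ i))) _) (moment λs∈ k∈ (k ℕ.≟ i)))))) ⟩
        ⅀[ λs ← partitions n ] c λs * ⅀ λs (λ k → ind (does (k ℕ.≟ i)) * homogeneousPart-moment D j (length λs ∸ 1)) ∎
        where
        H = homogeneousPart D j
        L = apply H
        select : ∀ W (e? : Dec (s W ≡ i)) →
          ind (does e?) * (sign W * ind (does (tf W ℕ.≟ j))) ≡ ind (does e?) * (sign W * L (λ m → rest m W))
        select W (no _)     = trans (ℚ.*-zeroˡ (sign W * ind (does (tf W ℕ.≟ j))))
                                    (sym (ℚ.*-zeroˡ (sign W * L (λ m → rest m W))))
        -- Only for |W| = i do the exponents of z and z - 1 add up to D = n ∸ i exactly; all other W
        -- are removed by the indicator.
        select W (yes refl) = cong (λ q → 1ℚ * (sign W * q)) (sym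
          (homogeneousPart-select D j (tf W) (kf W)
            (trans (sym (ℕ.m+n∸m≡n (s W) (tf W ℕ.+ kf W))) (cong (_∸ s W) (s+tf+kf W)))))
        moment : ∀ {λs k} → λs ∈ partitions n → k ∈ λs → (e? : Dec (k ≡ i)) →
          ind (does e?) * L (λ m → ι m ^ (length λs ∸ 1)) ≡ ind (does e?) * homogeneousPart-moment D j (length λs ∸ 1)
        moment {λs} λs∈ k∈ (no _) = trans (ℚ.*-zeroˡ (L (λ m → ι m ^ (length λs ∸ 1))))
                                          (sym (ℚ.*-zeroˡ (homogeneousPart-moment D j (length λs ∸ 1))))
        moment {λs} λs∈ k∈ (yes refl) with 0<λs , _ , eq ← partitions-sound n λs∈ =
          cong (1ℚ *_) (homogeneousPart-^ D j (length λs ∸ 1) (subst (ℕ._≤ D) (ℕ.m+n∸m≡n i (length λs ∸ 1))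
            (ℕ.∸-monoˡ-≤ i (subst (i ℕ.+ (length λs ∸ 1) ℕ.≤_) eq (part+length≤sum 0<λs k∈)))))

-- Subtrees

length-filter-∷ : ∀ {P : A → Set} (P? : ∀ a → Dec (P a)) a as →
                  length (filter P? (a ∷ as)) ≡ bit (does (P? a)) ℕ.+ length (filter P? as)
length-filter-∷ P? a as with does (P? a)
... | true  = refl
... | false = refl

module _ {n : ℕ} (T : Graph n) where
  open Graph T

  edges-unique : Unique edges
  edges-unique = Unique.filter⁺ _ (Unique.cartesianProduct⁺ (Unique.allFin⁺ n) (Unique.allFin⁺ n))

  ∈-edges⁺ : ∀ {u v} → u Fin.< v → u ~ v → (u , v) ∈ edges
  ∈-edges⁺ u<v u~v = ∈.∈-filter⁺ _ (∈.∈-cartesianProduct⁺ (∈-allFin _) (∈-allFin _)) (u<v , u~v)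

  ∈-edges⁻ : ∀ {u v} → (u , v) ∈ edges → u Fin.< v × u ~ v
  ∈-edges⁻ e∈ = proj₂ (∈.∈-filter⁻ _ {xs = cartesianProduct (allFin n) (allFin n)} e∈)

  -- Translates from the child-parent orientation of the growth to the orientation under which
  -- `edges` lists the same edge.
  increasing : Fin n × Fin n → Fin n × Fin n
  increasing (u , v) = if does (u Fin.<? v) then (u , v) else (v , u)

  increasing-cases : ∀ u v → increasing (u , v) ≡ (u , v) ⊎ increasing (u , v) ≡ (v , u)
  increasing-cases u v with does (u Fin.<? v)
  ... | true  = inj₁ refl
  ... | false = inj₂ refl

  increasing-< : ∀ {u v} → u Fin.< v → increasing (u , v) ≡ (u , v) × increasing (v , u) ≡ (u , v)
  increasing-< {u} {v} u<v
    rewrite dec-true (u Fin.<? v) u<v | dec-false (v Fin.<? u) (ℕ.<-asym u<v) = refl , refl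

  increasing-∈ : ∀ {u v} → u ~ v → increasing (u , v) ∈ edges
  increasing-∈ {u} {v} u~v with u Fin.<? v
  ... | yes u<v = subst (_∈ edges) (sym (proj₁ (increasing-< u<v))) (∈-edges⁺ u<v u~v)
  ... | no  u≮v = subst (_∈ edges) (sym (proj₂ (increasing-< v<u))) (∈-edges⁺ v<u (~-sym u~v))
    where
    v<u : v Fin.< u
    v<u = Fin.≤∧≢⇒< (ℕ.≮⇒≥ u≮v) λ { refl → ~-irrefl u~v }

  module _ {r : Fin n} where

    increasing-unique : ∀ {ps} → Grown T r ps → Unique (map increasing ps)
    increasing-unique seed = []
    increasing-unique (attach {ps} {v} {u} γ u∈ v∉ _ _) = All.tabulate fresh ∷ increasing-unique γ
      where
      fresh : ∀ {e} → e ∈ map increasing ps → increasing (v , u) ≢ e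
      fresh e∈ eq with (v′ , u′) , e′∈ , refl ← ∈.∈-map⁻ increasing e∈
        with increasing-cases v u | increasing-cases v′ u′
      ... | inj₁ p | inj₁ q with refl ← trans (sym p) (trans eq q) = v∉ (child∈ T γ e′∈)
      ... | inj₁ p | inj₂ q with refl ← trans (sym p) (trans eq q) = v∉ (parent∈ T γ e′∈)
      ... | inj₂ p | inj₁ q with refl ← trans (sym p) (trans eq q) = v∉ (parent∈ T γ e′∈)
      ... | inj₂ p | inj₂ q with refl ← trans (sym p) (trans eq q) = v∉ (child∈ T γ e′∈)

    -- `crosses?` is local to `d`, so the count is made for an arbitrary decision procedure of the
    -- crossing condition.
    length-filter-cut : ∀ (W : Subset n)
      (P? : ∀ e → Dec ((proj₁ e Subset.∈ W × proj₂ e Subset.∉ W) ⊎ (proj₁ e Subset.∉ W × proj₂ e Subset.∈ W)))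
      ps → length (filter P? (map increasing ps)) ≡ cut r ps W
    length-filter-cut W P? [] = refl
    length-filter-cut W P? ((v , u) ∷ ps) =
      trans (length-filter-∷ P? (increasing (v , u)) (map increasing ps))
            (cong₂ ℕ._+_ (cong bit crosses) (length-filter-cut W P? ps))
      where
      does-P : ∀ a b → does (P? (a , b)) ≡ not (does (lookup W a Bool.≟ lookup W b))
      does-P a b with lookup W a in eqᵃ | lookup W b in eqᵇ
      ... | true  | true  = dec-false (P? (a , b)) λ
        { (inj₁ (_ , b∉)) → b∉ (Vec.lookup⇒[]= b W eqᵇ) ; (inj₂ (a∉ , _)) → a∉ (Vec.lookup⇒[]= a W eqᵃ) }
      ... | true  | false = dec-true (P? (a , b)) (inj₁ (Vec.lookup⇒[]= a W eqᵃ , ∉ eqᵇ))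
        where
        ∉ : ∀ {x} → lookup W x ≡ false → x Subset.∉ W
        ∉ eq x∈ = contradiction (trans (sym eq) (Vec.[]=⇒lookup x∈)) λ ()
      ... | false | true  = dec-true (P? (a , b)) (inj₂ ((λ a∈ → contradiction (trans (sym eqᵃ) (Vec.[]=⇒lookup a∈)) λ ())
                                                        , Vec.lookup⇒[]= b W eqᵇ))
      ... | false | false = dec-false (P? (a , b)) λ
        { (inj₁ (a∈ , _)) → contradiction (trans (sym eqᵃ) (Vec.[]=⇒lookup a∈)) λ ()
        ; (inj₂ (_ , b∈)) → contradiction (trans (sym eqᵇ) (Vec.[]=⇒lookup b∈)) λ () }
      ≟-sym : ∀ a b → does (a Bool.≟ b) ≡ does (b Bool.≟ a)
      ≟-sym a b = does-⇔ (mk⇔ sym sym) (a Bool.≟ b) (b Bool.≟ a)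
      crosses : does (P? (increasing (v , u))) ≡ not (does (lookup W v Bool.≟ lookup W u))
      crosses with increasing-cases v u
      ... | inj₁ eq = trans (cong (does ∘ P?) eq) (does-P v u)
      ... | inj₂ eq = trans (cong (does ∘ P?) eq) (trans (does-P u v) (cong not (≟-sym (lookup W u) (lookup W v))))

    d≡cut : ∀ {ps} → Grown T r ps → (∀ x → x ∈ vertices r ps) → ∀ W → d W ≡ cut r ps W
    d≡cut {ps} γ spans W = trans (↭-length (filter-↭ _ edges-↭)) (length-filter-cut W _ ps)
      where
      to : ∀ {e} → e ∈ edges → e ∈ map increasing ps
      to {a , b} e∈ with a<b , a~b ← ∈-edges⁻ e∈ with grown-complete T γ (spans a) (spans b) a~b
      ... | inj₁ ab∈ = subst (_∈ map increasing ps) (proj₁ (increasing-< a<b)) (∈.∈-map⁺ increasing ab∈)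
      ... | inj₂ ba∈ = subst (_∈ map increasing ps) (proj₂ (increasing-< a<b)) (∈.∈-map⁺ increasing ba∈)
      from : ∀ {e} → e ∈ map increasing ps → e ∈ edges
      from e∈ with (v , u) , vu∈ , refl ← ∈.∈-map⁻ increasing e∈ = increasing-∈ (grown-sound T γ vu∈)
      edges-↭ : edges ↭ map increasing ps
      edges-↭ = ∼bag⇒↭ (unique∧set⇒bag edges-unique (increasing-unique γ) (mk⇔ to from))

    -- The root of the component of x after deleting the pairs that satisfy K.
    label : (Fin n → Fin n → Bool) → List (Fin n × Fin n) → Fin n → Fin n
    label K []             x = r
    label K ((v , u) ∷ ps) x = if does (x Fin.≟ v) then (if K v u then v else label K ps u) else label K ps x

    module _ (K : Fin n → Fin n → Bool) where

      label-old : ∀ {ps v u x} → v ∉ vertices r ps → x ∈ vertices r ps → label K ((v , u) ∷ ps) x ≡ label K ps x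
      label-old {v = v} {x = x} v∉ x∈ rewrite dec-false (x Fin.≟ v) (λ { refl → v∉ x∈ }) = refl

      label-new : ∀ ps v u → label K ((v , u) ∷ ps) v ≡ (if K v u then v else label K ps u)
      label-new ps v u rewrite dec-true (v Fin.≟ v) refl = refl

      label∈ : ∀ {ps} → Grown T r ps → ∀ {x} → x ∈ vertices r ps → label K ps x ∈ vertices r ps
      label∈ seed _ = here refl
      label∈ (attach {ps} {v} {u} γ u∈ _ _ _) (here refl) rewrite label-new ps v u with K v u
      ... | true  = here refl
      ... | false = there (label∈ γ u∈)
      label∈ (attach {u = u} γ _ v∉ _ _) (there x∈) rewrite label-old {u = u} v∉ x∈ = there (label∈ γ x∈)

      label-joined : ∀ {ps} → Grown T r ps → ∀ {v u} → (v , u) ∈ ps → K v u ≡ false →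
                     label K ps v ≡ label K ps u
      label-joined (attach {ps} {v} {u} γ u∈ v∉ _ _) (here refl) eq
        rewrite label-new ps v u | label-old {u = u} v∉ u∈ | eq = refl
      label-joined (attach {u = u} γ _ v∉ _ _) (there e∈) eq
        rewrite label-old {u = u} v∉ (child∈ T γ e∈) | label-old {u = u} v∉ (parent∈ T γ e∈) = label-joined γ e∈ eq

      -- A cut pair makes its child a root labelled by itself, while the parent's label lies among
      -- the vertices attached earlier. Later attachments change neither label.
      label-cut : ∀ {ps} → Grown T r ps → ∀ {v u} → (v , u) ∈ ps → K v u ≡ true → label K ps v ≢ label K ps u
      label-cut (attach {ps} {v} {u} γ u∈ v∉ _ _) (here refl) eq
        rewrite label-new ps v u | label-old {u = u} v∉ u∈ | eq = λ { p → v∉ (subst (_∈ vertices r ps) (sym p) (label∈ γ u∈)) }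
      label-cut (attach {u = u} γ _ v∉ _ _) (there e∈) eq
        rewrite label-old {u = u} v∉ (child∈ T γ e∈) | label-old {u = u} v∉ (parent∈ T γ e∈) = label-cut γ e∈ eq

    tops-empty : ∀ {ps} → Grown T r ps → ∀ W → (∀ {x} → x ∈ vertices r ps → lookup W x ≡ false) → tops true r ps W ≡ 0
    tops-empty seed W empty rewrite empty (here refl) = refl
    tops-empty (attach γ _ _ _ _) W empty rewrite empty (here refl) = tops-empty γ W (empty ∘ there)

    -- With the pairs whose parent lies outside W deleted, a vertex of W is labelled by the top of
    -- its component. A new top is labelled by itself, which no older vertex is, so equal labels
    -- force W to contain no older vertex.
    tops≤1 : ∀ {ps} → Grown T r ps → ∀ W ℓ →
      (∀ {x} → x ∈ vertices r ps → lookup W x ≡ true → label (λ _ u → not (lookup W u)) ps x ≡ ℓ) →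
      tops true r ps W ℕ.≤ 1
    tops≤1 seed W ℓ same with lookup W r
    ... | true  = s≤s z≤n
    ... | false = z≤n
    tops≤1 (attach {ps} {v} {u} γ u∈ v∉ _ _) W ℓ same = go (lookup W v) (lookup W u) refl refl
      where
      K : Fin n → Fin n → Bool
      K _ u = not (lookup W u)
      old : ∀ {x} → x ∈ vertices r ps → lookup W x ≡ true → label K ps x ≡ ℓ
      old x∈ Wx = trans (sym (label-old K {u = u} v∉ x∈)) (same (there x∈) Wx)
      go : ∀ b b′ → lookup W v ≡ b → lookup W u ≡ b′ →
           bit (does (b Bool.≟ true) ∧ not (does (b′ Bool.≟ true))) ℕ.+ tops true r ps W ℕ.≤ 1
      go true  true  _  _  = tops≤1 γ W ℓ old
      go false _     _  _  = tops≤1 γ W ℓ old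
      go true  false Wv ¬Wu = s≤s (ℕ.≤-reflexive (tops-empty γ W λ x∈ → Bool.¬-not λ Wx →
        v∉ (subst (_∈ vertices r ps) (trans (old x∈ Wx) ℓ≡v) (label∈ K γ x∈))))
        where
        ℓ≡v : ℓ ≡ v
        ℓ≡v = trans (sym (same (here refl) Wv))
          (trans (label-new K ps v u) (cong (λ b → if not b then v else label K ps u) ¬Wu))

    -- If W contains an older vertex, the only top is already among the older ones. The new vertex
    -- is then no top, its parent lies in W, and every walk can be routed through that parent.
    tops≤1⇒connected : ∀ {ps} → Grown T r ps → ∀ (W : Subset n) {R : Rel (Fin n) 0ℓ} → (∀ {u v} → R u v → R v u) →
      (∀ {v u} → (v , u) ∈ ps → lookup W v ≡ true → lookup W u ≡ true → R v u) →
      tops true r ps W ℕ.≤ 1 → ∀ {x y} → x ∈ vertices r ps → y ∈ vertices r ps →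
      lookup W x ≡ true → lookup W y ≡ true → Star R x y
    tops≤1⇒connected seed W R-sym step _ (here refl) (here refl) _ _ = ε
    tops≤1⇒connected (attach {ps} {v} {u} γ u∈ v∉ _ _) W {R} R-sym step one = go
      where
      tops-mono : tops true r ps W ℕ.≤ 1
      tops-mono = ℕ.≤-trans (ℕ.m≤n+m _ _) one
      connected′ : ∀ {x y} → x ∈ vertices r ps → y ∈ vertices r ps → lookup W x ≡ true → lookup W y ≡ true → Star R x y
      connected′ = tops≤1⇒connected γ W R-sym (step ∘ there) tops-mono
      parent-in : lookup W v ≡ true → ∀ {y} → y ∈ vertices r ps → lookup W y ≡ true → lookup W u ≡ true
      parent-in Wv y∈ Wy = case (lookup W v) (lookup W u) Wv one
        where
        case : ∀ b b′ → b ≡ true →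
          bit (does (b Bool.≟ true) ∧ not (does (b′ Bool.≟ true))) ℕ.+ tops true r ps W ℕ.≤ 1 → b′ ≡ true
        case true true  _ _          = refl
        case true false _ (s≤s none) =
          contradiction (trans (sym Wy) (no-tops T γ W (ℕ.n≤0⇒n≡0 none) y∈)) λ ()
      go : ∀ {x y} → x ∈ v ∷ vertices r ps → y ∈ v ∷ vertices r ps → lookup W x ≡ true → lookup W y ≡ true → Star R x y
      go (here refl) (here refl) _ _ = ε
      go (here refl) (there y∈) Wv Wy with Wu ← parent-in Wv y∈ Wy =
        step (here refl) Wv Wu ◅ connected′ u∈ y∈ Wu Wy
      go (there x∈) (here refl) Wx Wv with Wu ← parent-in Wv x∈ Wx =
        connected′ x∈ u∈ Wx Wu ◅◅ R-sym (step (here refl) Wv Wu) ◅ ε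
      go (there x∈) (there y∈) Wx Wy = connected′ x∈ y∈ Wx Wy

-- Subtrees as vertex sets with one component

module _ {n : ℕ} (T : Graph n) {r : Fin n} {ps : List (Fin n × Fin n)}
         (γ : Grown T r ps) (spans : ∀ x → x ∈ vertices r ps) where
  open Graph T

  oriented : ∀ {u v} → u ~ v → (u , v) ∈ ps ⊎ (v , u) ∈ ps
  oriented {u} {v} = grown-complete T γ (spans u) (spans v)

  endpoints : Fin (length edges) → Fin n × Fin n
  endpoints = List.lookup edges

  endpoints-~ : ∀ e {u v} → endpoints e ≡ (u , v) → u Fin.< v × u ~ v
  endpoints-~ e eq = ∈-edges⁻ T (subst (_∈ edges) eq (∈.∈-lookup e))

  joined-~ : ∀ H {u v} → Joined T H u v → u ~ v
  joined-~ H (e , _ , inj₁ eq) = proj₂ (endpoints-~ e eq)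
  joined-~ H (e , _ , inj₂ eq) = ~-sym (proj₂ (endpoints-~ e eq))

  joined-sym : ∀ H {u v} → Joined T H u v → Joined T H v u
  joined-sym H (e , e∈ , inj₁ eq) = e , e∈ , inj₂ eq
  joined-sym H (e , e∈ , inj₂ eq) = e , e∈ , inj₁ eq

  -- Serves two choices of `K`: the pairs with parent outside the vertex set, to bound the number of
  -- tops, and a single pair, to show that its edge cannot be missing.
  label-constant : ∀ (H : VertexEdgeSets T) K → (∀ {u v} → Joined T H u v → (u , v) ∈ ps → K u v ≡ false) →
    ∀ {u v} → Star (Joined T H) u v → label T K ps u ≡ label T K ps v
  label-constant H K uncut ε = refl
  label-constant H K uncut (J ◅ Js) with oriented (joined-~ H J)
  ... | inj₁ uv∈ = trans (label-joined T K γ uv∈ (uncut J uv∈)) (label-constant H K uncut Js)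
  ... | inj₂ vu∈ = trans (sym (label-joined T K γ vu∈ (uncut (joined-sym H J) vu∈))) (label-constant H K uncut Js)

  subtree⇒tops≡1 : ∀ V E → IsSubtree T (V , E) → tops true r ps V ≡ 1
  subtree⇒tops≡1 V E (subgraph , (x , x∈V) , connected) =
    ℕ.≤-antisym (tops≤1 T γ V (label T K ps x) same) (ℕ.n≢0⇒n>0 nonzero)
    where
    K : Fin n → Fin n → Bool
    K _ u = not (lookup V u)
    right∈ : ∀ {u v} → Joined T (V , E) u v → v Subset.∈ V
    right∈ (e , e∈ , inj₁ eq) = subst (Subset._∈ V) (cong proj₂ eq) (proj₂ (subgraph e e∈))
    right∈ (e , e∈ , inj₂ eq) = subst (Subset._∈ V) (cong proj₁ eq) (proj₁ (subgraph e e∈))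
    same : ∀ {y} → y ∈ vertices r ps → lookup V y ≡ true → label T K ps y ≡ label T K ps x
    same {y} _ Vy = label-constant (V , E) K (λ J _ → cong not (Vec.[]=⇒lookup (right∈ J)))
      (connected y x (Vec.lookup⇒[]= y V Vy) x∈V)
    nonzero : tops true r ps V ≢ 0
    nonzero none = contradiction (trans (sym (Vec.[]=⇒lookup x∈V)) (no-tops T γ V none (spans x))) λ ()

  inducedEdges : Subset n → Subset (length edges)
  inducedEdges V = Vec.tabulate (λ e → lookup V (proj₁ (endpoints e)) ∧ lookup V (proj₂ (endpoints e)))

  ∈-inducedEdges⁻ : ∀ V {e} → e Subset.∈ inducedEdges V →
                    proj₁ (endpoints e) Subset.∈ V × proj₂ (endpoints e) Subset.∈ V
  ∈-inducedEdges⁻ V {e} e∈ with both ← trans (sym (Vec.lookup∘tabulate _ e)) (Vec.[]=⇒lookup e∈) =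
    Vec.lookup⇒[]= _ V (∧-trueˡ both) , Vec.lookup⇒[]= _ V (∧-trueʳ both)
    where
    ∧-trueˡ : ∀ {a b} → a ∧ b ≡ true → a ≡ true
    ∧-trueˡ {true} _ = refl
    ∧-trueʳ : ∀ {a b} → a ∧ b ≡ true → b ≡ true
    ∧-trueʳ {true} eq = eq

  ∈-inducedEdges⁺ : ∀ V {e} → proj₁ (endpoints e) Subset.∈ V → proj₂ (endpoints e) Subset.∈ V →
                    e Subset.∈ inducedEdges V
  ∈-inducedEdges⁺ V {e} ∈₁ ∈₂ = Vec.lookup⇒[]= e (inducedEdges V)
    (trans (Vec.lookup∘tabulate _ e) (cong₂ _∧_ (Vec.[]=⇒lookup ∈₁) (Vec.[]=⇒lookup ∈₂)))

  induced-subtree : ∀ V → tops true r ps V ≡ 1 → IsSubtree T (V , inducedEdges V)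
  induced-subtree V one = (λ e → ∈-inducedEdges⁻ V) , nonempty , connected
    where
    nonempty : Nonempty V
    nonempty with nonempty? V
    ... | yes ne = ne
    ... | no ¬ne = contradiction (trans (sym one) (tops-empty T γ V λ {x} _ →
                     Bool.¬-not λ Vx → ¬ne (x , Vec.lookup⇒[]= x V Vx))) λ ()
    joined : ∀ {v u} → (v , u) ∈ ps → lookup V v ≡ true → lookup V u ≡ true → Joined T (V , inducedEdges V) v u
    joined {v} {u} vu∈ Vv Vu with increasing-∈ T (grown-sound T γ vu∈)
    ... | i∈ with e ← Any.index i∈ | eq ← lookup-index i∈ with increasing-cases T v u
    ...   | inj₁ eq′ = e , ∈-inducedEdges⁺ V
              (subst (Subset._∈ V) (cong proj₁ (trans (sym eq′) eq)) (Vec.lookup⇒[]= v V Vv))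
              (subst (Subset._∈ V) (cong proj₂ (trans (sym eq′) eq)) (Vec.lookup⇒[]= u V Vu)) , inj₁ (trans (sym eq) eq′)
    ...   | inj₂ eq′ = e , ∈-inducedEdges⁺ V
              (subst (Subset._∈ V) (cong proj₁ (trans (sym eq′) eq)) (Vec.lookup⇒[]= u V Vu))
              (subst (Subset._∈ V) (cong proj₂ (trans (sym eq′) eq)) (Vec.lookup⇒[]= v V Vv)) , inj₂ (trans (sym eq) eq′)
    connected : ∀ u v → u Subset.∈ V → v Subset.∈ V → Star (Joined T (V , inducedEdges V)) u v
    connected u v u∈ v∈ = tops≤1⇒connected T γ V (joined-sym (V , inducedEdges V)) joined (ℕ.≤-reflexive one)
      (spans u) (spans v) (Vec.[]=⇒lookup u∈) (Vec.[]=⇒lookup v∈)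

  endpoints-injective : ∀ {e e′ u v} → (endpoints e ≡ (u , v) ⊎ endpoints e ≡ (v , u)) →
    (endpoints e′ ≡ (u , v) ⊎ endpoints e′ ≡ (v , u)) → e ≡ e′
  endpoints-injective (inj₁ p) (inj₁ q) = lookup-injective (edges-unique T) (trans p (sym q))
  endpoints-injective (inj₂ p) (inj₂ q) = lookup-injective (edges-unique T) (trans p (sym q))
  endpoints-injective {e} {e′} (inj₁ p) (inj₂ q) =
    contradiction (proj₁ (endpoints-~ e′ q)) (ℕ.<-asym (proj₁ (endpoints-~ e p)))
  endpoints-injective {e} {e′} (inj₂ p) (inj₁ q) =
    contradiction (proj₁ (endpoints-~ e′ q)) (ℕ.<-asym (proj₁ (endpoints-~ e p)))

  -- Delete just this pair. Its ends then carry different labels, whereas every edge that a walk in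
  -- the subgraph can use preserves the label.
  missing-edge-separates : ∀ {V E e v u} → e Subset.∉ E → (v , u) ∈ ps →
    (endpoints e ≡ (v , u) ⊎ endpoints e ≡ (u , v)) → ¬ Star (Joined T (V , E)) v u
  missing-edge-separates {V} {E} {e} {v} {u} e∉ vu∈ ends v⋯u =
    label-cut T K γ vu∈ (dec-true (v Fin.≟ v ×-dec u Fin.≟ u) (refl , refl)) (label-constant (V , E) K uncut v⋯u)
    where
    K : Fin n → Fin n → Bool
    K v′ u′ = does (v′ Fin.≟ v ×-dec u′ Fin.≟ u)
    uncut : ∀ {v′ u′} → Joined T (V , E) v′ u′ → (v′ , u′) ∈ ps → K v′ u′ ≡ false
    uncut {v′} {u′} (e′ , e′∈ , ends′) _ = dec-false (v′ Fin.≟ v ×-dec u′ Fin.≟ u)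
      λ { (refl , refl) → e∉ (subst (Subset._∈ E) (endpoints-injective ends′ ends) e′∈) }

  subtree-edges : ∀ V E → IsSubtree T (V , E) → ∀ {e} → e Subset.∈ inducedEdges V → e Subset.∈ E
  subtree-edges V E (_ , _ , connected) {e} e∈ with e ∈? E
  ... | yes e∈E = e∈E
  ... | no  e∉E with ∈₁ , ∈₂ ← ∈-inducedEdges⁻ V e∈ with oriented (proj₂ (endpoints-~ e refl))
  ...   | inj₁ ab∈ = ⊥-elim (missing-edge-separates {V} e∉E ab∈ (inj₁ refl) (connected _ _ ∈₁ ∈₂))
  ...   | inj₂ ba∈ = ⊥-elim (missing-edge-separates {V} e∉E ba∈ (inj₂ refl) (connected _ _ ∈₂ ∈₁))

  subtree-edges≡ : ∀ V E → IsSubtree T (V , E) → inducedEdges V ≡ E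
  subtree-edges≡ V E H@(subgraph , _) = ⊆-antisym (subtree-edges V E H)
    (λ {e} e∈ → uncurry (∈-inducedEdges⁺ V) (subgraph e e∈))

  isSubtree-tops : ∀ V E → does (isSubtree? T (V , E))
                           ≡ does (tops true r ps V ℕ.≟ 1 ×-dec Vec.≡-dec Bool._≟_ (inducedEdges V) E)
  isSubtree-tops V E = does-⇔ (mk⇔
    (λ H → subtree⇒tops≡1 V E H , subtree-edges≡ V E H)
    (λ { (one , refl) → induced-subtree V one })) (isSubtree? T (V , E))
    (tops true r ps V ℕ.≟ 1 ×-dec Vec.≡-dec Bool._≟_ (inducedEdges V) E)

  -- The edge set of a subtree is forced to be `inducedEdges V`, so the sum over `E` collapses to
  -- one term.
  ∑-subtrees : ∀ (f : Subset n → ℚ) →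
    ⅀[ H ← subtrees T ] f (proj₁ H) ≡ ⅀[ V ← subsets n ] ind (does (tops true r ps V ℕ.≟ 1)) * f V
  ∑-subtrees f = begin
    ⅀[ H ← subtrees T ] f (proj₁ H)
      ≡⟨ ∑-filter (isSubtree? T) (cartesianProduct (subsets n) (subsets (length edges))) (f ∘ proj₁) ⟩
    ⅀[ H ← cartesianProduct (subsets n) (subsets (length edges)) ] ind (does (isSubtree? T H)) * f (proj₁ H)
      ≡⟨ ∑-cartesianProductWith _,_ (subsets n) (subsets (length edges)) _ ⟩
    ⅀[ V ← subsets n ] ⅀[ E ← subsets (length edges) ] ind (does (isSubtree? T (V , E))) * f V
      ≡⟨ ∑-cong (subsets n) (λ V → trans
           (∑-cong (subsets (length edges)) λ E → trans
             (cong (_* f V) (trans (cong ind (isSubtree-tops V E)) (ind-∧ (does (tops true r ps V ℕ.≟ 1)) _)))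
             (solve 3 (λ a b c → a :* b :* c := b :* (a :* c)) refl
                (ind (does (tops true r ps V ℕ.≟ 1))) (ind (does (Vec.≡-dec Bool._≟_ (inducedEdges V) E))) (f V)))
           (∑-select (Vec.≡-dec Bool._≟_) (allVecs-unique bools-unique (length edges))
             (∈-allVecs (inducedEdges V) λ _ → ∈-bools _) (λ _ → ind (does (tops true r ps V ℕ.≟ 1)) * f V))) ⟩
    ⅀[ V ← subsets n ] ind (does (tops true r ps V ℕ.≟ 1)) * f V ∎
    where open +-*-Solver

-- The coefficients σ as moments

/1≡fromℤ : ∀ z → z ℚ./ 1 ≡ fromℤ z
/1≡fromℤ z = ℚ.↥p/↧p≡p (fromℤ z)

fromℤ-* : ∀ a b → fromℤ (a ℤ.* b) ≡ fromℤ a * fromℤ b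
-- Multiplication of rationals with denominator 1 reduces to `(a * b) / 1`.
fromℤ-* a b = sym (/1≡fromℤ (a ℤ.* b))

fromℤ-+ : ∀ m → fromℤ (ℤ.+ m) ≡ ι m
fromℤ-+ zero    = refl
fromℤ-+ (suc m) = begin
  fromℤ (ℤ.+ suc m)
    ≡⟨ sym (/1≡fromℤ (ℤ.+ suc m)) ⟩
  (ℤ.+ 1 ℤ.+ ℤ.+ m) ℚ./ 1
    -- Addition of rationals cross-multiplies, which leaves a factor 1 at `+ m`.
    ≡⟨ cong (λ z → (ℤ.+ 1 ℤ.+ z) ℚ./ 1) (sym (ℤ.*-identityʳ (ℤ.+ m))) ⟩
  1ℚ + fromℤ (ℤ.+ m)
    ≡⟨ cong (1ℚ +_) (fromℤ-+ m) ⟩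
  1ℚ + ι m ∎

fromℤ-^ : ∀ k → fromℤ (ℤ.-1ℤ ℤ.^ k) ≡ (- 1ℚ) ^ k
fromℤ-^ zero    = refl
fromℤ-^ (suc k) = trans (fromℤ-* ℤ.-1ℤ (ℤ.-1ℤ ℤ.^ k)) (cong (- 1ℚ *_) (fromℤ-^ k))

∑-δ : ∀ i ks → ⅀[ k ← ks ] ind (does (k ℕ.≟ i)) ≡ ι (sum (map (λ k → δ k i) ks))
∑-δ i []       = ∑-[] _
∑-δ i (k ∷ ks) = trans (∑-∷ k ks _) (trans (cong₂ _+_ (head (does (k ℕ.≟ i))) (∑-δ i ks))
  (sym (ι-+ (δ k i) (sum (map (λ k → δ k i) ks)))))
  where
  head : ∀ b → ind b ≡ ι (if b then 1 else 0)
  head true  = refl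
  head false = refl

∑-δ≢0 : ∀ i ks → sum (map (λ k → δ k i) ks) ≢ 0 → i ∈ ks
∑-δ≢0 i []       ≢0 = contradiction refl ≢0
∑-δ≢0 i (k ∷ ks) ≢0 = go (k ℕ.≟ i) ≢0
  where
  go : ∀ (k? : Dec (k ≡ i)) → (if does k? then 1 else 0) ℕ.+ sum (map (λ k → δ k i) ks) ≢ 0 → i ∈ k ∷ ks
  go (yes refl) _  = here refl
  go (no _)     ≢0 = there (∑-δ≢0 i ks ≢0)

binomial-⊖ : ∀ N j k → binomial (ℤ.+ N) (j ℤ.⊖ k) ≡ ℤ.+ choose N j k
binomial-⊖ N j       zero    = refl
binomial-⊖ N zero    (suc k) = refl
binomial-⊖ N (suc j) (suc k) = trans (cong (binomial (ℤ.+ N)) (ℤ.[1+m]⊖[1+n]≡m⊖n j k)) (binomial-⊖ N j k)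

-- Parametrised by i-1, l-1 and N = n-i-l+1, so that the integer subtractions cancel and the upper
-- index is visibly nonnegative.
binomial-choose : ∀ i l N j →
  binomial (ℤ.+ (suc i ℕ.+ (l ℕ.+ N)) ℤ.- ℤ.+ suc i ℤ.- ℤ.+ suc l ℤ.+ ℤ.+ 1) (ℤ.+ j ℤ.- ℤ.+ suc l ℤ.+ ℤ.+ 1)
  ≡ ℤ.+ choose N j l
binomial-choose i l N j = trans (cong₂ binomial
  (solve 3 (λ s l N → (s :+ (l :+ N)) :- s :- (con (ℤ.+ 1) :+ l) :+ con (ℤ.+ 1) := N) refl
     (ℤ.+ suc i) (ℤ.+ l) (ℤ.+ N))
  (trans (solve 2 (λ j l → j :- (con (ℤ.+ 1) :+ l) :+ con (ℤ.+ 1) := j :- l) refl (ℤ.+ j) (ℤ.+ l))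
         (ℤ.m-n≡m⊖n j l)))
  (binomial-⊖ N j l)
  where
  open import Data.Integer.Solver using () renaming (module +-*-Solver to ℤ-Solver)
  open ℤ-Solver

-- For parts of size i+1 the exponent n-j-1 splits as i + (D-j) with D = n-(i+1): the first summand
-- is the sign of a connected set of that size, the second belongs to the functional in z.
σ-moment : ∀ n λs i j → λs ∈ partitions n → i ℕ.< n → j ℕ.≤ n ∸ suc i →
  σ n λs (suc i) j
  ≡ (- 1ℚ) ^ i * ⅀ λs (λ k → ind (does (k ℕ.≟ suc i)) * homogeneousPart-moment (n ∸ suc i) j (length λs ∸ 1))
σ-moment n λs i j λs∈ i<n j≤ = begin
  fromℤ (ℤ.-1ℤ ℤ.^ (n ∸ j ∸ 1) ℤ.* β ℤ.* ℤ.+ count)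
    ≡⟨ trans (fromℤ-* (ℤ.-1ℤ ℤ.^ (n ∸ j ∸ 1) ℤ.* β) (ℤ.+ count)) (cong₂ _*_
         (trans (fromℤ-* (ℤ.-1ℤ ℤ.^ (n ∸ j ∸ 1)) β) (cong (_* fromℤ β)
           (trans (fromℤ-^ (n ∸ j ∸ 1)) (trans (cong ((- 1ℚ) ^_) exponent) (^-homo-* (- 1ℚ) i (D ∸ j))))))
         (fromℤ-+ count)) ⟩
  (- 1ℚ) ^ i * (- 1ℚ) ^ (D ∸ j) * fromℤ β * ι count
    ≡⟨ coefficient ⟩
  (- 1ℚ) ^ i * (- 1ℚ) ^ (D ∸ j) * ι (choose (D ∸ l-1) j l-1) * ι count
    ≡⟨ solve 4 (λ a b c d → a :* b :* c :* d := a :* (d :* (b :* c))) refl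
         ((- 1ℚ) ^ i) ((- 1ℚ) ^ (D ∸ j)) (ι (choose (D ∸ l-1) j l-1)) (ι count) ⟩
  (- 1ℚ) ^ i * (ι count * homogeneousPart-moment D j l-1)
    ≡⟨ cong ((- 1ℚ) ^ i *_) (trans (cong (_* homogeneousPart-moment D j l-1) (sym (∑-δ (suc i) λs)))
         (∑-* (homogeneousPart-moment D j l-1) λs _)) ⟩
  (- 1ℚ) ^ i * ⅀ λs (λ k → ind (does (k ℕ.≟ suc i)) * homogeneousPart-moment D j l-1) ∎
  where
  open +-*-Solver
  D l-1 count : ℕ
  D = n ∸ suc i
  l-1 = length λs ∸ 1
  count = sum (map (λ k → δ k (suc i)) λs)
  β : ℤ
  β = binomial (ℤ.+ n ℤ.- ℤ.+ suc i ℤ.- ℤ.+ length λs ℤ.+ ℤ.+ 1) (ℤ.+ j ℤ.- ℤ.+ length λs ℤ.+ ℤ.+ 1)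
  n≡ : n ≡ suc i ℕ.+ D
  n≡ = sym (ℕ.m+[n∸m]≡n i<n)
  exponent : n ∸ j ∸ 1 ≡ i ℕ.+ (D ∸ j)
  exponent = trans (cong (λ n → n ∸ j ∸ 1) n≡) (cong (_∸ 1) (ℕ.+-∸-assoc (suc i) j≤))
  coefficient : (- 1ℚ) ^ i * (- 1ℚ) ^ (D ∸ j) * fromℤ β * ι count
                ≡ (- 1ℚ) ^ i * (- 1ℚ) ^ (D ∸ j) * ι (choose (D ∸ l-1) j l-1) * ι count
  coefficient with count ℕ.≟ 0
  -- Without a part of the required size the upper index may be negative and `β` is not a `choose`;
  -- the vanishing count removes it.
  ... | yes none = trans (vanish (u * fromℤ β)) (sym (vanish (u * ι (choose (D ∸ l-1) j l-1))))
    where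
    u = (- 1ℚ) ^ i * (- 1ℚ) ^ (D ∸ j)
    vanish : ∀ q → q * ι count ≡ 0ℚ
    vanish q = trans (cong (λ k → q * ι k) none) (ℚ.*-zeroʳ q)
  ... | no some  = cong (λ q → (- 1ℚ) ^ i * (- 1ℚ) ^ (D ∸ j) * q * ι count) (trans (cong fromℤ β≡) (fromℤ-+ _))
    where
    part : suc i ∈ λs
    part = ∑-δ≢0 (suc i) λs some
    l≡ : length λs ≡ suc l-1
    l≡ = nonempty part
      where
      nonempty : ∀ {k ks} → k ∈ ks → length ks ≡ suc (length ks ∸ 1)
      nonempty (here _)  = refl
      nonempty (there _) = refl
    l-1≤D : l-1 ℕ.≤ D
    l-1≤D with 0<λs , _ , eq ← partitions-sound n λs∈ = subst (ℕ._≤ D) (ℕ.m+n∸m≡n (suc i) l-1)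
      (ℕ.∸-monoˡ-≤ (suc i) (subst (suc i ℕ.+ l-1 ℕ.≤_) eq (part+length≤sum 0<λs part)))
    β≡ : β ≡ ℤ.+ choose (D ∸ l-1) j l-1
    β≡ = trans
      (cong₂ (λ n l → binomial (ℤ.+ n ℤ.- ℤ.+ suc i ℤ.- ℤ.+ l ℤ.+ ℤ.+ 1) (ℤ.+ j ℤ.- ℤ.+ l ℤ.+ ℤ.+ 1))
        (trans n≡ (cong (suc i ℕ.+_) (sym (ℕ.m+[n∸m]≡n l-1≤D)))) l≡)
      (binomial-choose i l-1 (D ∸ l-1) j)

-- Counting subtrees by size and cut

module _ {n : ℕ} (T : Graph n) {r : Fin n} {ps : List (Fin n × Fin n)}
         (γ : Grown T r ps) (spans : ∀ x → x ∈ vertices r ps)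
         (c : List ℕ → ℚ) (X≈ : IsPowerSumExpansion T c) where

  private
    s tt kt tf : Subset n → ℕ
    s  = size true r ps
    tt = tops true r ps
    kt = kept true r ps
    tf = tops false r ps

  -- A set with one top and i+1 vertices keeps i pairs, so its sign (-1)^i cancels against the
  -- factor (-1)^i split off from `σ`.
  subtree-count : ∀ i j → i ℕ.< n → j ℕ.≤ n ∸ suc i →
    ⅀[ λs ← partitions n ] σ n λs (suc i) j * c λs
    ≡ ⅀[ V ← subsets n ] ind (does (tt V ℕ.≟ 1)) * (ind (does (s V ℕ.≟ suc i)) * ind (does (tf V ℕ.≟ j)))
  subtree-count i j i<n j≤ = begin
    ⅀[ λs ← partitions n ] σ n λs (suc i) j * c λs
      ≡⟨ ∑-cong-∈ (partitions n) (λ {λs} λs∈ → trans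
           (cong (_* c λs) (σ-moment n λs i j λs∈ i<n j≤))
           (solve 3 (λ u m c → u :* m :* c := u :* (c :* m)) refl ((- 1ℚ) ^ i) _ (c λs))) ⟩
    ⅀[ λs ← partitions n ] (- 1ℚ) ^ i * (c λs * ⅀ λs (λ k →
      ind (does (k ℕ.≟ suc i)) * homogeneousPart-moment (n ∸ suc i) j (length λs ∸ 1)))
      ≡⟨ trans (sym (*-∑ ((- 1ℚ) ^ i) (partitions n) _))
               (cong ((- 1ℚ) ^ i *_) (sym (signed-count T γ spans c X≈ (suc i) j))) ⟩
    (- 1ℚ) ^ i * ⅀ (subsets n) (λ V →
      ind (does (s V ℕ.≟ suc i)) * (ind (does (tt V ℕ.≟ 1)) * (- 1ℚ) ^ kt V * ind (does (tf V ℕ.≟ j))))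
      ≡⟨ trans (*-∑ ((- 1ℚ) ^ i) (subsets n) _)
               (∑-cong (subsets n) λ V → sign-cancels V (s V ℕ.≟ suc i) (tt V ℕ.≟ 1) (ind (does (tf V ℕ.≟ j)))) ⟩
    ⅀[ V ← subsets n ] ind (does (tt V ℕ.≟ 1)) * (ind (does (s V ℕ.≟ suc i)) * ind (does (tf V ℕ.≟ j))) ∎
    where
    open +-*-Solver
    sign-cancels : ∀ V (s? : Dec (s V ≡ suc i)) (t? : Dec (tt V ≡ 1)) q →
      (- 1ℚ) ^ i * (ind (does s?) * (ind (does t?) * (- 1ℚ) ^ kt V * q)) ≡ ind (does t?) * (ind (does s?) * q)
    sign-cancels V (no _)  t?     q = solve 4 (λ u t v q → u :* (con 0ℚ :* (t :* v :* q)) := t :* (con 0ℚ :* q)) refl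
                                        ((- 1ℚ) ^ i) (ind (does t?)) ((- 1ℚ) ^ kt V) q
    sign-cancels V (yes _) (no _) q = solve 3 (λ u v q → u :* (con 1ℚ :* (con 0ℚ :* v :* q)) := con 0ℚ :* (con 1ℚ :* q)) refl
                                        ((- 1ℚ) ^ i) ((- 1ℚ) ^ kt V) q
    sign-cancels V (yes s≡) (yes t≡) q = begin
      (- 1ℚ) ^ i * (1ℚ * (1ℚ * (- 1ℚ) ^ kt V * q))
        ≡⟨ cong (λ k → (- 1ℚ) ^ i * (1ℚ * (1ℚ * (- 1ℚ) ^ k * q))) kt≡i ⟩
      (- 1ℚ) ^ i * (1ℚ * (1ℚ * (- 1ℚ) ^ i * q))
        ≡⟨ solve 2 (λ u q → u :* (con 1ℚ :* (con 1ℚ :* u :* q)) := u :* u :* q) refl ((- 1ℚ) ^ i) q ⟩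
      (- 1ℚ) ^ i * (- 1ℚ) ^ i * q
        ≡⟨ cong (_* q) ([-1]^k*[-1]^k i) ⟩
      1ℚ * q
        ≡⟨ sym (ℚ.*-identityˡ (1ℚ * q)) ⟩
      1ℚ * (1ℚ * q) ∎
      where
      kt≡i : kt V ≡ i
      kt≡i = ℕ.suc-injective (trans (cong (ℕ._+ kt V) (sym t≡)) (trans (tops+kept r true ps V) s≡))

  -- `g i j` stands for the coefficient of x^i y^j at one fixed exponent, so the regrouping by size
  -- and cut happens among rational numbers.
  F-count : ∀ (g : ℕ → ℕ → ℚ) →
    ⅀[ H ← subtrees T ] g (∣ proj₁ H ∣) (Graph.d T (proj₁ H))
    ≡ ⅀[ i ← map suc (upTo n) ] ⅀[ j ← upTo (suc (n ∸ i)) ] (⅀[ λs ← partitions n ] σ n λs i j * c λs) * g i j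
  F-count g = begin
    ⅀[ H ← subtrees T ] g (∣ proj₁ H ∣) (Graph.d T (proj₁ H))
      ≡⟨ ∑-subtrees T γ spans (λ V → g (∣ V ∣) (Graph.d T V)) ⟩
    ⅀[ V ← subsets n ] ind (does (tt V ℕ.≟ 1)) * g (∣ V ∣) (Graph.d T V)
      ≡⟨ ∑-cong (subsets n) (λ V → collect V (tt V ℕ.≟ 1)) ⟩
    ⅀[ V ← subsets n ] ind (does (tt V ℕ.≟ 1)) * (⅀[ i ← is ] ind (does (s V ℕ.≟ i)) *
      (⅀[ j ← js i ] ind (does (tf V ℕ.≟ j)) * g i j))
      ≡⟨ ∑-cong (subsets n) (λ V → trans (*-∑ (top V) is _) (∑-cong is λ i →
           trans (sym (ℚ.*-assoc (top V) _ _)) (trans (*-∑ (top V * ind (does (s V ℕ.≟ i))) (js i) _)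
             (∑-cong (js i) λ j → solve 4 (λ a b c d → a :* b :* (c :* d) := a :* (b :* c) :* d) refl
                (top V) (ind (does (s V ℕ.≟ i))) (ind (does (tf V ℕ.≟ j))) (g i j))))) ⟩
    ⅀[ V ← subsets n ] ⅀[ i ← is ] ⅀[ j ← js i ]
      top V * (ind (does (s V ℕ.≟ i)) * ind (does (tf V ℕ.≟ j))) * g i j
      ≡⟨ trans (∑-swap (subsets n) is _) (∑-cong is λ i → trans (∑-swap (subsets n) (js i) _)
           (∑-cong (js i) λ j → sym (∑-* (g i j) (subsets n) _))) ⟩
    ⅀[ i ← is ] ⅀[ j ← js i ]
      (⅀[ V ← subsets n ] top V * (ind (does (s V ℕ.≟ i)) * ind (does (tf V ℕ.≟ j)))) * g i j
      ≡⟨ ∑-cong-∈ is (λ i∈ → coefficients (∈.∈-map⁻ suc i∈)) ⟩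
    ⅀[ i ← is ] ⅀[ j ← js i ] (⅀[ λs ← partitions n ] σ n λs i j * c λs) * g i j ∎
    where
    open +-*-Solver
    is : List ℕ
    is = map suc (upTo n)
    js : ℕ → List ℕ
    js i = upTo (suc (n ∸ i))
    top : Subset n → ℚ
    top V = ind (does (tt V ℕ.≟ 1))
    coefficients : ∀ {i} → (∃[ i′ ] i′ ∈ upTo n × i ≡ suc i′) →
      ⅀[ j ← js i ] (⅀[ V ← subsets n ] top V * (ind (does (s V ℕ.≟ i)) * ind (does (tf V ℕ.≟ j)))) * g i j
      ≡ ⅀[ j ← js i ] (⅀[ λs ← partitions n ] σ n λs i j * c λs) * g i j
    coefficients (i′ , i′∈ , refl) = ∑-cong-∈ (js (suc i′)) λ {j} j∈ →
      cong (_* g (suc i′) j) (sym (subtree-count i′ j (∈.∈-upTo⁻ i′∈) (ℕ.≤-pred (∈.∈-upTo⁻ j∈))))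
    -- Each component of the complement has its own top, a vertex outside V; therefore the range j ≤
    -- n ∸ i misses no subtree.
    s+tf≤n : ∀ V → s V ℕ.+ tf V ℕ.≤ n
    s+tf≤n V = ℕ.≤-trans (ℕ.+-monoʳ-≤ (s V) (subst (tf V ℕ.≤_) (tops+kept r false ps V) (ℕ.m≤m+n (tf V) _)))
      (ℕ.≤-reflexive (trans (size+size r ps V) (suc-length-ps T γ spans)))
    collect : ∀ V (t? : Dec (tt V ≡ 1)) → ind (does t?) * g (∣ V ∣) (Graph.d T V)
      ≡ ind (does t?) * (⅀[ i ← is ] ind (does (s V ℕ.≟ i)) * (⅀[ j ← js i ] ind (does (tf V ℕ.≟ j)) * g i j))
    collect V (no _)   = trans (ℚ.*-zeroˡ (g (∣ V ∣) (Graph.d T V))) 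
      (sym (ℚ.*-zeroˡ (⅀[ i ← is ] ind (does (s V ℕ.≟ i)) * (⅀[ j ← js i ] ind (does (tf V ℕ.≟ j)) * g i j))))
    collect V (yes t≡) = cong (1ℚ *_) (begin
      g (∣ V ∣) (Graph.d T V)
        ≡⟨ cong₂ g (sym (size≡∣∣ T γ spans V)) (trans (d≡cut T γ spans V)
             (ℕ.suc-injective (trans (sym (tops+tops r ps V)) (cong (ℕ._+ tf V) t≡)))) ⟩
      g (s V) (tf V)
        ≡⟨ sym (∑-select ℕ._≟_ (Unique.upTo⁺ _) (∈.∈-upTo⁺ (s≤s tf≤)) (g (s V))) ⟩
      ⅀[ j ← js (s V) ] ind (does (tf V ℕ.≟ j)) * g (s V) j
        ≡⟨ sym (∑-select ℕ._≟_ (Unique.map⁺ ℕ.suc-injective (Unique.upTo⁺ n)) s∈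
             (λ i → ⅀[ j ← js i ] ind (does (tf V ℕ.≟ j)) * g i j)) ⟩
      ⅀[ i ← is ] ind (does (s V ℕ.≟ i)) * (⅀[ j ← js i ] ind (does (tf V ℕ.≟ j)) * g i j) ∎)
      where
      tf≤ : tf V ℕ.≤ n ∸ s V
      tf≤ = subst (ℕ._≤ n ∸ s V) (ℕ.m+n∸m≡n (s V) (tf V)) (ℕ.∸-monoˡ-≤ (s V) (s+tf≤n V))
      -- One top makes the size positive, as the range of `is` starts at 1.
      s≡ : suc (kt V) ≡ s V
      s≡ = trans (cong (ℕ._+ kt V) (sym t≡)) (tops+kept r true ps V)
      s∈ : s V ∈ is
      s∈ = subst (_∈ is) s≡ (∈.∈-map⁺ suc (∈.∈-upTo⁺ (subst (ℕ._≤ n) (sym s≡)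
             (ℕ.≤-trans (ℕ.m≤m+n (s V) (tf V)) (s+tf≤n V)))))

theorem4p2 : ∀ {n : ℕ} (T : Graph n) → IsTree T →
    ∀ (c : List ℕ → ℚ) → IsPowerSumExpansion T c →
    F T ≈ ∑[ i ← map suc (upTo n) ] ∑[ j ← upTo (suc (n ∸ i)) ]
    (∑ℚ[ λs ← partitions n ] (σ n λs i j * c λs)) • (x ↑ i ⊗ y ↑ j)
theorem4p2 {zero} T tree c X≈ m with () ← IsTree.nonempty tree
theorem4p2 {n@(suc _)} T tree c X≈ m
  with ps , γ , spans ← spanning-growth T {zero} (IsTree.connected tree) (IsTree.acyclic tree) = begin
  F T m
    ≡⟨ ∑-at (subtrees T) (λ H → x ↑ ∣ proj₁ H ∣ ⊗ y ↑ Graph.d T (proj₁ H)) m ⟩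
  ⅀[ H ← subtrees T ] g (∣ proj₁ H ∣) (Graph.d T (proj₁ H))
    ≡⟨ F-count T γ spans c X≈ g ⟩
  ⅀[ i ← map suc (upTo n) ] ⅀[ j ← upTo (suc (n ∸ i)) ] (⅀[ λs ← partitions n ] σ n λs i j * c λs) * g i j
    ≡⟨ ∑-cong (map suc (upTo n)) (λ i → trans
         (∑-cong (upTo (suc (n ∸ i))) λ j → cong (_* g i j) (sym (∑ℚ≡⅀ (partitions n) λ λs → σ n λs i j * c λs)))
         (sym (∑-at (upTo (suc (n ∸ i))) (term i) m))) ⟩
  ⅀[ i ← map suc (upTo n) ] ∑ (upTo (suc (n ∸ i))) (term i) m
    ≡⟨ sym (∑-at (map suc (upTo n)) (λ i → ∑ (upTo (suc (n ∸ i))) (term i)) m) ⟩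
  ∑ (map suc (upTo n)) (λ i → ∑ (upTo (suc (n ∸ i))) (term i)) m ∎
  where
  g : ℕ → ℕ → ℚ
  g i j = (x ↑ i ⊗ y ↑ j) m
  term : ℕ → ℕ → Series 2
  term i j = (∑ℚ[ λs ← partitions n ] (σ n λs i j * c λs)) • (x ↑ i ⊗ y ↑ j)
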